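{- Let $G$ be a graph with $n$ vertices, and let $b,a,m,\Delta$ be non-negative integers with $b-\Delta\ge a\ge 2$, $\delta(G)\ge\frac{(\Delta+a)n}{b+2a+\Delta}+\frac{b(b-\Delta)}{\Delta+a}+m$ and $n>\frac{(b+a+2m-1)(b+2a+\Delta)}{\Delta+a}$. Let $g,f$ be integer-valued functions on $V(G)$ with $b-\Delta\ge f(x)-\Delta\ge g(x)\ge a$ for every vertex $x$. If for every pair of distinct non-adjacent vertices $x,y$ (i.e. $xy\notin E(G)$) we have $\max\{d_G(y),d_G(x)\}\ge\frac{(b+a)n}{b+2a+\Delta}$, then $G$ is fractional ID-$(g,f,m)$-deleted.
   Context: All graphs are finite and simple; $\delta(G)$ is the minimum degree and $d_G(x)$ the degree of $x$. For integer-valued functions $g\le f$ on $V(G)$, a fractional $(g,f)$-factor of $G$ is a function $h:E(G)\to[0,1]$ such that $g(x)\le\sum_{e\ni x}h(e)\le f(x)$ for every vertex $x$. $G$ is fractional $(g,f,m)$-deleted if for every $H\subseteq E(G)$ with $|H|=m$, $G-H$ has a fractional $(g,f)$-factor. $G$ is fractional ID-$(g,f,m)$-deleted if for every independent set $I\subseteq V(G)$, $G-I$ is fractional $(g,f,m)$-deleted (with $g,f$ restricted to $V(G)\setminus I$). -}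

module Defs where

open import Data.Bool using (Bool; true; false; _∧_; not; if_then_else_)
open import Data.Nat as ℕ using (ℕ; zero; suc; _+_; _*_; _∸_; _⊔_)
open import Data.Fin using (Fin; toℕ)
open import Data.List using (List; []; _∷_; map; foldr; length; filter; concatMap)
open import Data.Nat.ListAction using (sum)
open import Data.List using (allFin)
open import Data.Integer using (+_)
open import Data.Rational as ℚ using (ℚ; 0ℚ; 1ℚ)
open import Data.Product using (_×_; _,_)
open import Relation.Binary.PropositionalEquality using (_≡_)
open import Relation.Nullary using (¬_)

record Graph (n : ℕ) : Set where
  field
    adj   : Fin n → Fin n → Bool
    sym   : ∀ x y → adj x y ≡ adj y x
    irref : ∀ x → adj x x ≡ false
open Graph public

deg : ∀ {n} → Graph n → Fin n → ℕ
deg {n} G x = sum (map (λ y → if adj G x y then 1 else 0) (allFin n))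

VSet : ℕ → Set
VSet n = Fin n → Bool

Independent : ∀ {n} → Graph n → VSet n → Set
Independent G I = ∀ x y → I x ≡ true → I y ≡ true → adj G x y ≡ false

adjMinus : ∀ {n} → Graph n → VSet n → Fin n → Fin n → Bool
adjMinus G I x y = not (I x) ∧ (not (I y) ∧ adj G x y)

EdgeSubset : ∀ {n} → (Fin n → Fin n → Bool) → (Fin n → Fin n → Bool) → Set
EdgeSubset H A = (∀ x y → H x y ≡ H y x) × (∀ x y → H x y ≡ true → A x y ≡ true)

edgeCount : ∀ {n} → (Fin n → Fin n → Bool) → ℕ
edgeCount {n} H =
  sum (concatMap (λ x → map (λ y → if (toℕ x ℕ.<ᵇ toℕ y) ∧ H x y then 1 else 0)
                             (allFin n))
                 (allFin n))

sumℚ : List ℚ → ℚ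
sumℚ = foldr ℚ._+_ 0ℚ

fromℕℚ : ℕ → ℚ
fromℕℚ k = (+ k) ℚ./ 1

-- A fractional (g,f)-factor of the graph with vertex set V ⊆ Fin n
-- (given by the predicate V) and edge relation A (edges inside V).
-- h is given on ordered pairs and required symmetric, so it is a function
-- on edges; values in [0,1]; for every vertex x ∈ V,
--   g(x) ≤ Σ_{e ∋ x} h(e) ≤ f(x).
FracFactor : ∀ {n} → VSet n → (Fin n → Fin n → Bool) → (g f : Fin n → ℕ) → Set
FracFactor {n} V A g f =
  Data.Product.Σ (Fin n → Fin n → ℚ) λ h →
      (∀ x y → h x y ≡ h y x)
    × (∀ x y → A x y ≡ true → (0ℚ ℚ.≤ h x y) × (h x y ℚ.≤ 1ℚ))
    × (∀ x → V x ≡ true →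
         let s = sumℚ (map (λ y → if A x y then h x y else 0ℚ) (allFin n)) in
         (fromℕℚ (g x) ℚ.≤ s) × (s ℚ.≤ fromℕℚ (f x)))

FracDeleted : ∀ {n} → VSet n → (Fin n → Fin n → Bool) → (g f : Fin n → ℕ) → ℕ → Set
FracDeleted V A g f m =
  ∀ H → EdgeSubset H A → edgeCount H ≡ m →
    FracFactor V (λ x y → A x y ∧ not (H x y)) g f

FracIDDeleted : ∀ {n} → Graph n → (g f : Fin n → ℕ) → ℕ → Set
FracIDDeleted G g f m =
  ∀ I → Independent G I → FracDeleted (λ x → not (I x)) (adjMinus G I) g f m

{-# OPTIONS --safe #-}
module Submission where

-- A fractional (g,f)-factor is the average of a 0/1 matrix inside the adjacency matrix, all of whose
-- row and column sums lie in [g,f], and its transpose.  Such a matrix is found by augmentation, which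
-- can only get stuck at disjoint S, T with f(S) + Σ_{x ∈ T} d_{G'-S}(x) < g(T), where G' = G - I - H.
--
-- Write c = Δ + a, B = b - Δ, K = b + 2a + Δ = 2c + B.  Non-adjacent pairs in I force |I| ≤ cn/K.
-- Let d be the degree in G - I - S (before H is deleted), d₁ its minimum on T, attained at x₁, and
-- D its minimum on the vertices of T not in N[x₁].  If D ≥ B, or there are no such vertices, only
-- the at most d₁ + 1 vertices of T in N[x₁] can contribute negatively, and the minimum degree
-- condition makes S too large.  Otherwise the degree condition on x₁ and a vertex attaining D gives
-- |S| ≥ (b + a)n/K - |I| - D, and this together with |I| + |S| + |T| ≤ n and the lower bound on n
-- contradicts the choice of S, T.

open import Defs renaming (sym to adj-sym)
open import Data.Nat using (ℕ; zero; suc; _+_; _*_; _∸_; _≤_; _<_; _⊔_; _⊓_; z≤n; s≤s; s≤s⁻¹; _<?_; _<ᵇ_; >-nonZero)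
open import Data.Nat.Properties
import Data.Nat.ListAction as ListAction
open import Data.Nat.ListAction.Properties using (sum-++)
open import Data.Nat.Tactic.RingSolver using (solve)
open import Algebra.Properties.Semiring.Sum +-*-semiring using (sum; sum-cong-≗; ∑-distrib-+; ∑-comm; *-distribˡ-sum; *-distribʳ-sum)
open import Data.Fin using (Fin; zero; suc; toℕ)
open import Data.Fin.Properties using (any?; toℕ-injective) renaming (_≟_ to _≟F_)
open import Data.List using (List; []; _∷_; tabulate; map; allFin; concat; concatMap)
open import Data.List.Properties using (map-tabulate)
open import Data.Bool using (Bool; true; false; _∧_; _∨_; not; if_then_else_) renaming (T to IsTrue)
open import Data.Bool.Properties using (¬-not; not-¬) renaming (_≟_ to _≟B_)
open import Data.Product using (Σ; ∃; _×_; _,_; proj₁; proj₂)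
open import Data.Sum using (_⊎_; inj₁; inj₂)
open import Data.Empty using (⊥; ⊥-elim)
import Data.Integer as ℤ
import Data.Integer.Properties as ℤ
import Data.Integer.Tactic.RingSolver as ℤ-Solver
open import Data.Rational as ℚ using (ℚ; 0ℚ)
import Data.Rational.Properties as ℚ
open import Data.Rational.Unnormalised as ℚᵘ using (mkℚᵘ; *≡*; *≤*)
import Data.Rational.Unnormalised.Properties as ℚᵘ
open import Function using (id; _∘_; case_of_)
open import Relation.Nullary using (¬_; yes; no; does)
open import Relation.Nullary.Decidable using (_×-dec_; ¬?)
open import Relation.Binary.PropositionalEquality using (_≡_; _≢_; refl; sym; trans; cong; cong₂; subst; subst₂; module ≡-Reasoning)

-- Augmentation in the bipartite double cover

𝟙 : Bool → ℕ
𝟙 b = if b then 1 else 0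

δ : ∀ {n} → Fin n → Fin n → ℕ
δ x y = 𝟙 (does (x ≟F y))

δ-refl : ∀ {n} (x : Fin n) → δ x x ≡ 1
δ-refl x with x ≟F x
... | yes _ = refl
... | no x≢x = ⊥-elim (x≢x refl)

δ-≢ : ∀ {n} {x y : Fin n} → x ≢ y → δ x y ≡ 0
δ-≢ {x = x} {y} x≢y with x ≟F y
... | yes x≡y = ⊥-elim (x≢y x≡y)
... | no _ = refl

sum-zero : ∀ n → sum {n} (λ _ → 0) ≡ 0
sum-zero zero = refl
sum-zero (suc n) = sum-zero n

sum-mono-≤ : ∀ {n} {u v : Fin n → ℕ} → (∀ i → u i ≤ v i) → sum u ≤ sum v
sum-mono-≤ {zero} u≤v = z≤n
sum-mono-≤ {suc n} u≤v = +-mono-≤ (u≤v zero) (sum-mono-≤ (λ i → u≤v (suc i)))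

sum-mono-< : ∀ {n} {u v : Fin n → ℕ} → (∀ i → u i ≤ v i) → ∀ k → u k < v k → sum u < sum v
sum-mono-< u≤v zero uk<vk = +-mono-<-≤ uk<vk (sum-mono-≤ (λ i → u≤v (suc i)))
sum-mono-< u≤v (suc k) uk<vk = +-mono-≤-< (u≤v zero) (sum-mono-< (λ i → u≤v (suc i)) k uk<vk)

sum-δ : ∀ {n} (k : Fin n) → sum (δ k) ≡ 1
sum-δ {suc n} zero = cong suc (sum-zero n)
sum-δ {suc n} (suc k) = sum-δ k

row col : ∀ {n} → (Fin n → Fin n → Bool) → Fin n → ℕ
row h x = sum (λ y → 𝟙 (h x y))
col h y = sum (λ x → 𝟙 (h x y))

insert : ∀ {n} → Fin n → VSet n → VSet n
insert x X u = does (x ≟F u) ∨ X u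

insert-self : ∀ {n} (x : Fin n) X → insert x X x ≡ true
insert-self x X with x ≟F x
... | yes _ = refl
... | no x≢x = ⊥-elim (x≢x refl)

insert-⊇ : ∀ {n} (x : Fin n) X u → insert x X u ≡ false → X u ≡ false
insert-⊇ x X u p with x ≟F u
... | no _ = p

insert-elim : ∀ {n} (x : Fin n) X (P : Fin n → Set) → P x → (∀ u → X u ≡ true → P u) →
  ∀ u → insert x X u ≡ true → P u
insert-elim x X P px pX u p with x ≟F u
... | yes refl = px
... | no _ = pX u p

count-insert : ∀ {n} (x : Fin n) X → X x ≡ false →
  sum (λ u → 𝟙 (not (insert x X u))) < sum (λ u → 𝟙 (not (X u)))
count-insert x X x∉X = sum-mono-< le x lt
  where
  le : ∀ u → 𝟙 (not (insert x X u)) ≤ 𝟙 (not (X u))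
  le u with x ≟F u
  ... | yes _ = z≤n
  ... | no _ = ≤-refl
  lt : 𝟙 (not (insert x X x)) < 𝟙 (not (X x))
  lt rewrite insert-self x X | x∉X = s≤s z≤n

set : ∀ {n} → (Fin n → Fin n → Bool) → Fin n → Fin n → Bool → Fin n → Fin n → Bool
set h x y b u w = if does (x ≟F u) ∧ does (y ≟F w) then b else h u w

set-elim : ∀ {n} (h : Fin n → Fin n → Bool) x y b (P : Fin n → Fin n → Bool → Set) →
  P x y b → ∀ u w → P u w (h u w) → P u w (set h x y b u w)
set-elim h x y b P p u w q with x ≟F u | y ≟F w
... | yes refl | yes refl = p
... | yes _ | no _ = q
... | no _ | _ = q

set-true : ∀ {n} (h : Fin n → Fin n → Bool) x y → h x y ≡ false →
  ∀ u w → 𝟙 (set h x y true u w) ≡ 𝟙 (h u w) + δ x u * δ y w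
set-true h x y hxy u w with x ≟F u | y ≟F w
... | yes refl | yes refl rewrite hxy = refl
... | yes _ | no _ = sym (+-identityʳ _)
... | no _ | _ = sym (+-identityʳ _)

set-false : ∀ {n} (h : Fin n → Fin n → Bool) x y → h x y ≡ true →
  ∀ u w → 𝟙 (h u w) ≡ 𝟙 (set h x y false u w) + δ x u * δ y w
set-false h x y hxy u w with x ≟F u | y ≟F w
... | yes refl | yes refl rewrite hxy = refl
... | yes _ | no _ = sym (+-identityʳ _)
... | no _ | _ = sym (+-identityʳ _)

-- Switching an entry on satisfies `bump` directly, and switching it off satisfies it with the two
-- matrices exchanged. Both directions share these counts, and no subtraction occurs.
module _ {n : ℕ} (h h′ : Fin n → Fin n → Bool) (x y : Fin n)
         (bump : ∀ u w → 𝟙 (h′ u w) ≡ 𝟙 (h u w) + δ x u * δ y w) where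
  open ≡-Reasoning

  row-bump : ∀ u → row h′ u ≡ row h u + δ x u
  row-bump u = begin
    row h′ u                                  ≡⟨ sum-cong-≗ (bump u) ⟩
    sum (λ w → 𝟙 (h u w) + δ x u * δ y w)     ≡⟨ ∑-distrib-+ (λ w → 𝟙 (h u w)) _ ⟩
    row h u + sum (λ w → δ x u * δ y w)       ≡⟨ cong (row h u +_) (sym (*-distribˡ-sum (δ x u) (δ y))) ⟩
    row h u + δ x u * sum (δ y)               ≡⟨ cong (λ k → row h u + δ x u * k) (sum-δ y) ⟩
    row h u + δ x u * 1                       ≡⟨ cong (row h u +_) (*-identityʳ _) ⟩
    row h u + δ x u                           ∎

  col-bump : ∀ w → col h′ w ≡ col h w + δ y w
  col-bump w = begin
    col h′ w                                  ≡⟨ sum-cong-≗ (λ u → trans (bump u w) (cong (𝟙 (h u w) +_) (*-comm (δ x u) (δ y w)))) ⟩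
    sum (λ u → 𝟙 (h u w) + δ y w * δ x u)     ≡⟨ ∑-distrib-+ (λ u → 𝟙 (h u w)) _ ⟩
    col h w + sum (λ u → δ y w * δ x u)       ≡⟨ cong (col h w +_) (sym (*-distribˡ-sum (δ y w) (δ x))) ⟩
    col h w + δ y w * sum (δ x)               ≡⟨ cong (λ k → col h w + δ y w * k) (sum-δ x) ⟩
    col h w + δ y w * 1                       ≡⟨ cong (col h w +_) (*-identityʳ _) ⟩
    col h w + δ y w                           ∎

_⊆ᵣ_ : ∀ {n} → (Fin n → Fin n → Bool) → (Fin n → Fin n → Bool) → Set
h ⊆ᵣ A = ∀ u w → h u w ≡ true → A u w ≡ true

-- A Hall-type obstruction: the rows in `T` need `g(T)` ones, while the columns in `S` admit at most
-- `f(S)` of them and the other columns at most the entries of `A` there.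
Violator : ∀ {n} → (Fin n → Fin n → Bool) → (g f : Fin n → ℕ) → Set
Violator {n} A g f = Σ (VSet n) λ S → Σ (VSet n) λ T →
  sum (λ y → 𝟙 (S y) * f y) + sum (λ x → sum (λ y → 𝟙 (T x ∧ not (S y) ∧ A x y)))
    < sum (λ x → 𝟙 (T x) * g x)

-- The search for an augmentation at x₀.  Instead of alternating paths we carry, for every
-- vertex reached so far, the matrix obtained by switching along such a path.
module _ {n : ℕ} (A : Fin n → Fin n → Bool) (g f : Fin n → ℕ)
         (h : Fin n → Fin n → Bool) (h⊆A : h ⊆ᵣ A) (x₀ : Fin n) (deficient : row h x₀ < g x₀) where

  -- Every switched entry lies in `X` × `Y`, so an entry whose row or column is only now being
  -- reached still has its value in `h` and can be flipped.
  AgreeOff : VSet n → VSet n → (Fin n → Fin n → Bool) → Set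
  AgreeOff X Y h′ = ∀ u w → X u ≡ false ⊎ Y w ≡ false → h′ u w ≡ h u w

  -- The two kinds of ends of an alternating path from `x₀`. At a row `x` the path has moved a one
  -- from row `x` to row `x₀`; at a column `y` it has added a one to row `x₀` and to column `y`. The
  -- term `δ x u` on the left replaces a subtraction.
  SwitchL SwitchR : VSet n → VSet n → Fin n → Set
  SwitchL X Y x = Σ (Fin n → Fin n → Bool) λ h′ → h′ ⊆ᵣ A × AgreeOff X Y h′ ×
    (∀ u → row h′ u + δ x u ≡ row h u + δ x₀ u) × (∀ w → col h′ w ≡ col h w)
  SwitchR X Y y = Σ (Fin n → Fin n → Bool) λ h′ → h′ ⊆ᵣ A × AgreeOff X Y h′ ×
    (∀ u → row h′ u ≡ row h u + δ x₀ u) × (∀ w → col h′ w ≡ col h w + δ y w)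

  record Reached (X Y : VSet n) : Set where
    field
      x₀∈X   : X x₀ ≡ true
      switchL : ∀ x → X x ≡ true → SwitchL X Y x
      switchR : ∀ y → Y y ≡ true → SwitchR X Y y
      -- A reached row above `g` or a reached column below `f` would already be an augmentation, so
      -- these two bounds persist while the search runs.
      rowLow  : ∀ x → X x ≡ true → row h x ≤ g x
      colFull : ∀ y → Y y ≡ true → f y ≤ col h y
  open Reached

  Augmentation : Set
  Augmentation = Σ (VSet n) λ X → Σ (VSet n) λ Y →
    (Σ (Fin n) λ x → g x < row h x × SwitchL X Y x) ⊎ (Σ (Fin n) λ y → col h y < f y × SwitchR X Y y)

  agreeL : ∀ {X Y h′} x → AgreeOff X Y h′ → AgreeOff (insert x X) Y h′
  agreeL {X} x ag u w (inj₁ p) = ag u w (inj₁ (insert-⊇ x X u p))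
  agreeL {X} x ag u w (inj₂ p) = ag u w (inj₂ p)

  agreeR : ∀ {X Y h′} y → AgreeOff X Y h′ → AgreeOff X (insert y Y) h′
  agreeR {Y = Y} y ag u w (inj₁ p) = ag u w (inj₁ p)
  agreeR {Y = Y} y ag u w (inj₂ p) = ag u w (inj₂ (insert-⊇ y Y w p))

  extendR : ∀ {X Y x y} → X x ≡ true → Y y ≡ false → A x y ≡ true → h x y ≡ false →
    SwitchL X Y x → SwitchR X (insert y Y) y
  extendR {X} {Y} {x} {y} Xx Yy Axy hxy (h′ , h′⊆A , ag , rows , cols) =
    set h′ x y true ,
    (λ u w → set-elim h′ x y true (λ u w b → b ≡ true → A u w ≡ true) (λ _ → Axy) u w (h′⊆A u w)) ,
    (λ u w → set-elim h′ x y true (λ u w b → X u ≡ false ⊎ insert y Y w ≡ false → b ≡ h u w) off u w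
               (agreeR {X} {Y} {h′} y ag u w)) ,
    (λ u → trans (row-bump h′ (set h′ x y true) x y (set-true h′ x y h′xy) u) (rows u)) ,
    (λ w → trans (col-bump h′ (set h′ x y true) x y (set-true h′ x y h′xy) w) (cong (_+ δ y w) (cols w)))
    where
    h′xy : h′ x y ≡ false
    h′xy = trans (ag x y (inj₂ Yy)) hxy
    off : X x ≡ false ⊎ insert y Y y ≡ false → true ≡ h x y
    off (inj₁ p) with () ← trans (sym Xx) p
    off (inj₂ p) with () ← trans (sym (insert-self y Y)) p

  extendL : ∀ {X Y x y} → Y y ≡ true → X x ≡ false → h x y ≡ true →
    SwitchR X Y y → SwitchL (insert x X) Y x
  extendL {X} {Y} {x} {y} Yy Xx hxy (h′ , h′⊆A , ag , rows , cols) =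
    set h′ x y false ,
    (λ u w → set-elim h′ x y false (λ u w b → b ≡ true → A u w ≡ true) (λ ()) u w (h′⊆A u w)) ,
    (λ u w → set-elim h′ x y false (λ u w b → insert x X u ≡ false ⊎ Y w ≡ false → b ≡ h u w) off u w
               (agreeL {X} {Y} {h′} x ag u w)) ,
    (λ u → trans (sym (row-bump (set h′ x y false) h′ x y (set-false h′ x y h′xy) u)) (rows u)) ,
    (λ w → +-cancelʳ-≡ (δ y w) _ _
             (trans (sym (col-bump (set h′ x y false) h′ x y (set-false h′ x y h′xy) w)) (cols w)))
    where
    h′xy : h′ x y ≡ true
    h′xy = trans (ag x y (inj₁ Xx)) hxy
    off : insert x X x ≡ false ⊎ Y y ≡ false → false ≡ h x y
    off (inj₁ p) with () ← trans (sym (insert-self x X)) p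
    off (inj₂ p) with () ← trans (sym Yy) p

  -- When nothing more can be reached, `h` uses every entry of `A` from `X` to columns outside `Y`,
  -- and all ones of the full columns in `Y` lie in rows of `X`. Together these are at most the ones
  -- in the rows of `X`, hence at most `g(X)`, strictly because of `x₀`.
  closed-violator : ∀ {X Y} → Reached X Y →
    (∀ x y → X x ≡ true → Y y ≡ false → A x y ≡ true → h x y ≡ true) →
    (∀ x y → Y y ≡ true → h x y ≡ true → X x ≡ true) → Violator A g f
  closed-violator {X} {Y} R outX inY = Y , X , (begin-strict
    sum (λ y → 𝟙 (Y y) * f y) + sum (λ x → sum (E x))
      ≤⟨ +-monoˡ-≤ _ (sum-mono-≤ fY) ⟩
    sum (λ y → sum (λ x → 𝟙 (Y y) * 𝟙 (h x y))) + sum (λ x → sum (E x))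
      ≡⟨ cong (_+ sum (λ x → sum (E x))) (∑-comm (λ y x → 𝟙 (Y y) * 𝟙 (h x y))) ⟩
    sum (λ x → sum (λ y → 𝟙 (Y y) * 𝟙 (h x y))) + sum (λ x → sum (E x))
      ≡⟨ sym (∑-distrib-+ (λ x → sum (λ y → 𝟙 (Y y) * 𝟙 (h x y))) _) ⟩
    sum (λ x → sum (λ y → 𝟙 (Y y) * 𝟙 (h x y)) + sum (E x))
      ≡⟨ sum-cong-≗ (λ x → sym (∑-distrib-+ (λ y → 𝟙 (Y y) * 𝟙 (h x y)) (E x))) ⟩
    sum (λ x → sum (λ y → 𝟙 (Y y) * 𝟙 (h x y) + E x y))
      ≤⟨ sum-mono-≤ (λ x → sum-mono-≤ (cell x)) ⟩
    sum (λ x → sum (λ y → 𝟙 (X x) * 𝟙 (h x y)))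
      ≡⟨ sum-cong-≗ (λ x → sym (*-distribˡ-sum (𝟙 (X x)) (λ y → 𝟙 (h x y)))) ⟩
    sum (λ x → 𝟙 (X x) * row h x)
      <⟨ sum-mono-< rowX x₀ strict₀ ⟩
    sum (λ x → 𝟙 (X x) * g x) ∎)
    where
    open ≤-Reasoning
    E : Fin n → Fin n → ℕ
    E x y = 𝟙 (X x ∧ not (Y y) ∧ A x y)
    fY : ∀ y → 𝟙 (Y y) * f y ≤ sum (λ x → 𝟙 (Y y) * 𝟙 (h x y))
    fY y with Y y in Yy
    ... | false = z≤n
    ... | true = subst (f y + 0 ≤_) (*-distribˡ-sum 1 (λ x → 𝟙 (h x y)))
                   (+-monoˡ-≤ 0 (colFull R y Yy))
    cell : ∀ x y → 𝟙 (Y y) * 𝟙 (h x y) + E x y ≤ 𝟙 (X x) * 𝟙 (h x y)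
    cell x y with X x in Xx | Y y in Yy | A x y in Axy | h x y in hxy
    ... | false | false | _ | _ = z≤n
    ... | false | true | _ | false = z≤n
    ... | false | true | _ | true with () ← trans (sym Xx) (inY x y Yy hxy)
    cell x y | true | false | false | _ = z≤n
    cell x y | true | false | true | true = ≤-refl
    cell x y | true | false | true | false with () ← trans (sym hxy) (outX x y Xx Yy Axy)
    cell x y | true | true | _ | false = z≤n
    cell x y | true | true | _ | true = ≤-refl
    rowX : ∀ x → 𝟙 (X x) * row h x ≤ 𝟙 (X x) * g x
    rowX x with X x in Xx
    ... | false = z≤n
    ... | true = +-monoˡ-≤ 0 (rowLow R x Xx)
    strict₀ : 𝟙 (X x₀) * row h x₀ < 𝟙 (X x₀) * g x₀
    strict₀ rewrite x₀∈X R = +-monoˡ-< 0 deficient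

  -- The fuel `k` exceeds the number of unreached rows and columns, which drops with each insertion.
  search : ∀ k X Y → sum (λ u → 𝟙 (not (X u))) + sum (λ w → 𝟙 (not (Y w))) < k →
    Reached X Y → Augmentation ⊎ Violator A g f
  search (suc k) X Y (s≤s fuel) R
    with any? (λ x → any? (λ y → (X x ≟B true) ×-dec (Y y ≟B false) ×-dec (A x y ≟B true) ×-dec (h x y ≟B false)))
  ... | yes (x , y , Xx , Yy , Axy , hxy) with col h y <? f y
  ...   | yes c<f = inj₁ (X , insert y Y , inj₂ (y , c<f , extendR Xx Yy Axy hxy (switchL R x Xx)))
  ...   | no c≮f = search k X (insert y Y) (<-≤-trans (+-monoʳ-< _ (count-insert y Y Yy)) fuel) record
          { x₀∈X   = x₀∈X R
          ; switchL = λ u Xu → let h′ , h′⊆A , ag , rows , cols = switchL R u Xu in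
              h′ , h′⊆A , agreeR {X} {Y} {h′} y ag , rows , cols
          ; switchR = insert-elim y Y (SwitchR X (insert y Y)) (extendR Xx Yy Axy hxy (switchL R x Xx))
              (λ w Yw → let h′ , h′⊆A , ag , rows , cols = switchR R w Yw in
                h′ , h′⊆A , agreeR {X} {Y} {h′} y ag , rows , cols)
          ; rowLow  = rowLow R
          ; colFull = insert-elim y Y (λ w → f w ≤ col h w) (≮⇒≥ c≮f) (colFull R) }
  search (suc k) X Y (s≤s fuel) R | no closedX
    with any? (λ x → any? (λ y → (Y y ≟B true) ×-dec (X x ≟B false) ×-dec (h x y ≟B true)))
  ... | yes (x , y , Yy , Xx , hxy) with g x <? row h x
  ...   | yes g<r = inj₁ (insert x X , Y , inj₁ (x , g<r , extendL Yy Xx hxy (switchR R y Yy)))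
  ...   | no g≮r = search k (insert x X) Y (<-≤-trans (+-monoˡ-< _ (count-insert x X Xx)) fuel) record
          { x₀∈X   = ¬-not (λ p → x₀∉X-absurd (insert-⊇ x X x₀ p))
          ; switchL = insert-elim x X (SwitchL (insert x X) Y) (extendL Yy Xx hxy (switchR R y Yy))
              (λ u Xu → let h′ , h′⊆A , ag , rows , cols = switchL R u Xu in
                h′ , h′⊆A , agreeL {X} {Y} {h′} x ag , rows , cols)
          ; switchR = λ w Yw → let h′ , h′⊆A , ag , rows , cols = switchR R w Yw in
              h′ , h′⊆A , agreeL {X} {Y} {h′} x ag , rows , cols
          ; rowLow  = insert-elim x X (λ u → row h u ≤ g u) (≮⇒≥ g≮r) (rowLow R)
          ; colFull = colFull R }
    where
    x₀∉X-absurd : X x₀ ≡ false → ⊥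
    x₀∉X-absurd p with () ← trans (sym (x₀∈X R)) p
  search (suc k) X Y (s≤s fuel) R | no closedX | no closedY = inj₂ (closed-violator R
    (λ x y Xx Yy Axy → ¬-not (λ hxy → closedX (x , y , Xx , Yy , Axy , hxy)))
    (λ x y Yy hxy → ¬-not (λ Xx → closedY (x , y , Yy , Xx , hxy))))

  augment : Augmentation ⊎ Violator A g f
  augment = search _ (insert x₀ (λ _ → false)) (λ _ → false) (n<1+n _) record
    { x₀∈X   = insert-self x₀ _
    ; switchL = insert-elim x₀ (λ _ → false) (SwitchL _ _)
        (h , h⊆A , (λ _ _ _ → refl) , (λ _ → refl) , (λ _ → refl)) (λ _ ())
    ; switchR = λ _ ()
    ; rowLow  = insert-elim x₀ (λ _ → false) (λ u → row h u ≤ g u) (<⇒≤ deficient) (λ _ ())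
    ; colFull = λ _ () }

-- Repeated augmentation to a 0/1 factor

deficiency : ∀ {n} → (g : Fin n → ℕ) → (Fin n → Fin n → Bool) → ℕ
deficiency g h = sum (λ x → g x ∸ row h x) + sum (λ y → g y ∸ col h y)

-- Only the upper bounds are kept invariant; the lower ones are reached by decreasing `deficiency`.
UpperFactor : ∀ {n} → (Fin n → Fin n → Bool) → (f : Fin n → ℕ) → (Fin n → Fin n → Bool) → Set
UpperFactor A f h = h ⊆ᵣ A × (∀ x → row h x ≤ f x) × (∀ y → col h y ≤ f y)

-- An augmentation adds one to row `x₀`, which stays within `f` because it was below `g`. Only a row
-- with more than `g` ones can lose a one, so no new deficiency appears, and only a column with room
-- below `f` can gain one.
improve : ∀ {n} (A : Fin n → Fin n → Bool) (g f : Fin n → ℕ) → (∀ x → g x ≤ f x) →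
  ∀ h → UpperFactor A f h → ∀ x₀ → row h x₀ < g x₀ →
  (Σ (Fin n → Fin n → Bool) λ h′ → UpperFactor A f h′ × deficiency g h′ < deficiency g h) ⊎ Violator A g f
improve A g f g≤f h (h⊆A , r≤f , c≤f) x₀ def with augment A g f h h⊆A x₀ def
... | inj₂ v = inj₂ v
... | inj₁ (X , Y , inj₁ (x , g<r , h′ , h′⊆A , _ , rows , cols)) = inj₁ (h′ ,
        (h′⊆A , r′≤f , λ y → subst (_≤ f y) (sym (cols y)) (c≤f y)) ,
        +-mono-<-≤ (sum-mono-< gain x₀ strict₀)
          (≤-reflexive (sum-cong-≗ λ y → cong (g y ∸_) (cols y))))
  where
  x≢x₀ : x ≢ x₀
  x≢x₀ refl = <-asym g<r def
  at-x₀ : row h′ x₀ ≡ suc (row h x₀)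
  at-x₀ = begin
    row h′ x₀             ≡⟨ sym (+-identityʳ _) ⟩
    row h′ x₀ + 0         ≡⟨ cong (row h′ x₀ +_) (sym (δ-≢ x≢x₀)) ⟩
    row h′ x₀ + δ x x₀    ≡⟨ rows x₀ ⟩
    row h x₀ + δ x₀ x₀    ≡⟨ cong (row h x₀ +_) (δ-refl x₀) ⟩
    row h x₀ + 1          ≡⟨ +-comm _ 1 ⟩
    suc (row h x₀)        ∎
    where open ≡-Reasoning
  r′≤f : ∀ u → row h′ u ≤ f u
  r′≤f u with x₀ ≟F u
  ... | yes refl = subst (_≤ f x₀) (sym at-x₀) (≤-trans def (g≤f x₀))
  ... | no x₀≢u = ≤-trans (m+n≤o⇒m≤o _ (≤-reflexive (trans (rows u)
                    (trans (cong (row h u +_) (δ-≢ x₀≢u)) (+-identityʳ _))))) (r≤f u)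
  gain : ∀ u → g u ∸ row h′ u ≤ g u ∸ row h u
  gain u with x ≟F u
  ... | yes refl = ≤-trans (≤-reflexive (m≤n⇒m∸n≡0 (s≤s⁻¹ g<1+r′))) z≤n
    where
    g<1+r′ : g x < suc (row h′ x)
    g<1+r′ = begin-strict
      g x                  <⟨ g<r ⟩
      row h x              ≤⟨ m≤m+n _ (δ x₀ x) ⟩
      row h x + δ x₀ x     ≡⟨ sym (rows x) ⟩
      row h′ x + δ x x     ≡⟨ cong (row h′ x +_) (δ-refl x) ⟩
      row h′ x + 1         ≡⟨ +-comm _ 1 ⟩
      suc (row h′ x)       ∎
      where open ≤-Reasoning
  ... | no x≢u = ∸-monoʳ-≤ (g u) (≤-trans (m≤m+n _ (δ x₀ u)) (≤-reflexive
                   (trans (sym (rows u)) (trans (cong (row h′ u +_) (δ-≢ x≢u)) (+-identityʳ _)))))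
  strict₀ : g x₀ ∸ row h′ x₀ < g x₀ ∸ row h x₀
  strict₀ rewrite at-x₀ = ∸-monoʳ-< (n<1+n _) def
... | inj₁ (X , Y , inj₂ (y , c<f , h′ , h′⊆A , _ , rows , cols)) = inj₁ (h′ ,
        (h′⊆A , r′≤f , c′≤f) ,
        +-mono-<-≤ (sum-mono-< (λ u → ∸-monoʳ-≤ (g u) (≤-trans (m≤m+n _ (δ x₀ u)) (≤-reflexive (sym (rows u))))) x₀ strict₀)
          (sum-mono-≤ λ w → ∸-monoʳ-≤ (g w) (≤-trans (m≤m+n _ (δ y w)) (≤-reflexive (sym (cols w))))))
  where
  at-x₀ : row h′ x₀ ≡ suc (row h x₀)
  at-x₀ = trans (rows x₀) (trans (cong (row h x₀ +_) (δ-refl x₀)) (+-comm _ 1))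
  r′≤f : ∀ u → row h′ u ≤ f u
  r′≤f u with x₀ ≟F u
  ... | yes refl = subst (_≤ f x₀) (sym at-x₀) (≤-trans def (g≤f x₀))
  ... | no x₀≢u = ≤-trans (≤-reflexive (trans (rows u)
                    (trans (cong (row h u +_) (δ-≢ x₀≢u)) (+-identityʳ _)))) (r≤f u)
  c′≤f : ∀ w → col h′ w ≤ f w
  c′≤f w with y ≟F w
  ... | yes refl = subst (_≤ f y) (sym (trans (cols y) (trans (cong (col h y +_) (δ-refl y)) (+-comm _ 1)))) c<f
  ... | no y≢w = ≤-trans (≤-reflexive (trans (cols w)
                    (trans (cong (col h w +_) (δ-≢ y≢w)) (+-identityʳ _)))) (c≤f w)
  strict₀ : g x₀ ∸ row h′ x₀ < g x₀ ∸ row h x₀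
  strict₀ rewrite at-x₀ = ∸-monoʳ-< (n<1+n _) def

Factor : ∀ {n} → (Fin n → Fin n → Bool) → (g f : Fin n → ℕ) → (Fin n → Fin n → Bool) → Set
Factor A g f h = UpperFactor A f h × (∀ x → g x ≤ row h x) × (∀ y → g y ≤ col h y)

module _ {n : ℕ} (A : Fin n → Fin n → Bool) (A-sym : ∀ x y → A x y ≡ A y x)
         (g f : Fin n → ℕ) (g≤f : ∀ x → g x ≤ f x) where

  factor-from : ∀ k h → UpperFactor A f h → deficiency g h < k → (∃ (Factor A g f)) ⊎ Violator A g f
  factor-from (suc k) h U@(h⊆A , r≤f , c≤f) (s≤s bound) with any? (λ x → row h x <? g x)
  ... | yes (x , def) with improve A g f g≤f h U x def
  ...   | inj₁ (h′ , U′ , lt) = factor-from k h′ U′ (<-≤-trans lt bound)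
  ...   | inj₂ v = inj₂ v
  factor-from (suc k) h U@(h⊆A , r≤f , c≤f) (s≤s bound) | no rowsOk with any? (λ y → col h y <? g y)
  ... | no colsOk = inj₁ (h , U , (λ x → ≮⇒≥ (λ lt → rowsOk (x , lt))) , (λ y → ≮⇒≥ (λ lt → colsOk (y , lt))))
  -- A deficient column is a deficient row of the transpose, which lies in `A` by symmetry; a
  -- violator found there is one for the same `A`, `g` and `f`.
  ... | yes (y , def) with improve A g f g≤f (λ u w → h w u)
                             ((λ u w p → trans (A-sym u w) (h⊆A w u p)) , c≤f , r≤f) y def
  ...   | inj₂ v = inj₂ v
  ...   | inj₁ (h′ , (h′⊆A , r′≤f , c′≤f) , lt) = factor-from k (λ u w → h′ w u)
          ((λ u w p → trans (A-sym u w) (h′⊆A w u p)) , c′≤f , r′≤f)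
          (<-≤-trans (≤-<-trans (≤-reflexive (+-comm (sum (λ y → g y ∸ col h′ y)) _))
            (<-≤-trans lt (≤-reflexive (+-comm (sum (λ x → g x ∸ col h x)) _)))) bound)

  factor-or-violator : (∃ (Factor A g f)) ⊎ Violator A g f
  factor-or-violator = factor-from _ (λ _ _ → false)
    ((λ _ _ ()) , (λ x → ≤-trans (≤-reflexive (sum-zero n)) z≤n) , (λ x → ≤-trans (≤-reflexive (sum-zero n)) z≤n)) (n<1+n _)

-- From 0/1 matrices to fractional factors

-- The averaged weights are multiples of one half, so rational sums and comparisons reduce to
-- natural numbers of halves.
half : ℕ → ℚ
half k = (ℤ.+ k) ℚ./ 2

half-+ : ∀ j k → half j ℚ.+ half k ≡ half (j + k)
half-+ j k = ℚ.toℚᵘ-injective (begin-equality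
  ℚ.toℚᵘ (half j ℚ.+ half k)               ≃⟨ ℚ.toℚᵘ-homo-+ (half j) (half k) ⟩
  ℚ.toℚᵘ (half j) ℚᵘ.+ ℚ.toℚᵘ (half k)     ≃⟨ ℚᵘ.+-cong (ℚ.toℚᵘ-fromℚᵘ (mkℚᵘ (ℤ.+ j) 1)) (ℚ.toℚᵘ-fromℚᵘ (mkℚᵘ (ℤ.+ k) 1)) ⟩
  mkℚᵘ (ℤ.+ j) 1 ℚᵘ.+ mkℚᵘ (ℤ.+ k) 1           ≃⟨ *≡* (identity (ℤ.+ j) (ℤ.+ k)) ⟩
  mkℚᵘ (ℤ.+ (j + k)) 1                       ≃⟨ ℚᵘ.≃-sym (ℚ.toℚᵘ-fromℚᵘ (mkℚᵘ (ℤ.+ (j + k)) 1)) ⟩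
  ℚ.toℚᵘ (half (j + k))                    ∎)
  where
  open ℚᵘ.≤-Reasoning
  identity : ∀ x y → (x ℤ.* (ℤ.+ 2) ℤ.+ y ℤ.* (ℤ.+ 2)) ℤ.* (ℤ.+ 2) ≡ (x ℤ.+ y) ℤ.* (ℤ.+ 4)
  identity = ℤ-Solver.solve-∀

half-mono : ∀ {j k} → j ≤ k → half j ℚ.≤ half k
half-mono {j} {k} j≤k = ℚ.toℚᵘ-cancel-≤ (begin
  ℚ.toℚᵘ (half j)   ≃⟨ ℚ.toℚᵘ-fromℚᵘ (mkℚᵘ (ℤ.+ j) 1) ⟩
  mkℚᵘ (ℤ.+ j) 1      ≤⟨ *≤* (ℤ.*-monoʳ-≤-nonNeg (ℤ.+ 2) (ℤ.+≤+ j≤k)) ⟩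
  mkℚᵘ (ℤ.+ k) 1      ≃⟨ ℚᵘ.≃-sym (ℚ.toℚᵘ-fromℚᵘ (mkℚᵘ (ℤ.+ k) 1)) ⟩
  ℚ.toℚᵘ (half k)   ∎)
  where open ℚᵘ.≤-Reasoning

fromℕℚ≡half : ∀ k → fromℕℚ k ≡ half (k + k)
fromℕℚ≡half k = ℚ.fromℚᵘ-cong {mkℚᵘ (ℤ.+ k) 0} {mkℚᵘ (ℤ.+ (k + k)) 1} (*≡* (identity (ℤ.+ k)))
  where
  identity : ∀ x → x ℤ.* (ℤ.+ 2) ≡ (x ℤ.+ x) ℤ.* (ℤ.+ 1)
  identity = ℤ-Solver.solve-∀

sumℚ-half : ∀ {n} (u : Fin n → ℚ) (k : Fin n → ℕ) → (∀ y → u y ≡ half (k y)) →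
  sumℚ (map u (allFin n)) ≡ half (sum k)
sumℚ-half u k u≡k = trans (cong sumℚ (map-tabulate id u)) (tab u k u≡k)
  where
  tab : ∀ {n} (u : Fin n → ℚ) (k : Fin n → ℕ) → (∀ y → u y ≡ half (k y)) →
    sumℚ (tabulate u) ≡ half (sum k)
  tab {zero} u k u≡k = refl
  tab {suc n} u k u≡k = trans (cong₂ ℚ._+_ (u≡k zero) (tab (u ∘ suc) (k ∘ suc) (u≡k ∘ suc))) (half-+ (k zero) _)

listSum≡sum : ∀ {n} (u : Fin n → ℕ) → ListAction.sum (map u (allFin n)) ≡ sum u
listSum≡sum u = trans (cong ListAction.sum (map-tabulate id u)) (tab u)
  where
  tab : ∀ {n} (u : Fin n → ℕ) → ListAction.sum (tabulate u) ≡ sum u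
  tab {zero} u = refl
  tab {suc n} u = cong (u zero +_) (tab (u ∘ suc))

∧-fst : ∀ {u v} → u ∧ v ≡ true → u ≡ true
∧-fst {true} _ = refl

-- Disjoint violators and averaging with the transpose

sum-symmetrise : ∀ {n} (u : Fin n → Fin n → ℕ) →
  sum (λ x → sum (λ y → u x y + u y x)) ≡ sum (λ x → sum (u x)) + sum (λ x → sum (u x))
sum-symmetrise u = begin
  sum (λ x → sum (λ y → u x y + u y x))                        ≡⟨ sum-cong-≗ (λ x → ∑-distrib-+ (u x) _) ⟩
  sum (λ x → sum (u x) + sum (λ y → u y x))                    ≡⟨ ∑-distrib-+ (λ x → sum (u x)) _ ⟩
  sum (λ x → sum (u x)) + sum (λ x → sum (λ y → u y x))        ≡⟨ cong (sum (λ x → sum (u x)) +_) (∑-comm (λ x y → u y x)) ⟩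
  sum (λ x → sum (u x)) + sum (λ x → sum (u x))                ∎
  where open ≡-Reasoning

-- For a symmetric edge relation a violator may be made disjoint: on replacing S, T by S ∖ T, T ∖ S
-- the edge term does not grow once the contributions of (x, y) and (y, x) are added up.
swap-cell : ∀ sx tx sy ty →
  𝟙 ((tx ∧ not sx) ∧ not (sy ∧ not ty) ∧ true) + 𝟙 ((ty ∧ not sy) ∧ not (sx ∧ not tx) ∧ true)
    ≤ 𝟙 (tx ∧ not sy ∧ true) + 𝟙 (ty ∧ not sx ∧ true)
swap-cell sx false sy false = z≤n
swap-cell false false false true = ≤-refl
swap-cell false false true true = z≤n
swap-cell true false false true = z≤n
swap-cell true false true true = z≤n
swap-cell false true false false = ≤-refl
swap-cell false true true false = z≤n
swap-cell true true false false = z≤n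
swap-cell true true true false = z≤n
swap-cell false true false true = ≤-refl
swap-cell false true true true = ≤-refl
swap-cell true true false true = ≤-refl
swap-cell true true true true = z≤n

record DisjointViolator {n : ℕ} (V : VSet n) (A : Fin n → Fin n → Bool) (g f : Fin n → ℕ) : Set where
  field
    S T : VSet n
    S⊆V : ∀ x → S x ≡ true → V x ≡ true
    T⊆V : ∀ x → T x ≡ true → V x ≡ true
    disjoint : ∀ x → S x ≡ true → T x ≡ false
    violates : sum (λ y → 𝟙 (S y) * f y) + sum (λ x → sum (λ y → 𝟙 (T x ∧ not (S y) ∧ A x y)))
                 < sum (λ x → 𝟙 (T x) * g x)

module _ {n : ℕ} (V : VSet n) (A : Fin n → Fin n → Bool) (A-sym : ∀ x y → A x y ≡ A y x)
         (A⊆V : ∀ x y → A x y ≡ true → V x ≡ true)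
         (g f : Fin n → ℕ) (g≤f : ∀ x → g x ≤ f x) where

  -- `g` and `f` are cut to zero outside `V`, so restricting `S` and `T` to `V` changes neither
  -- vertex sum. Removing the common part lowers the `f` side by at least as much as the `g` side,
  -- since `g ≤ f`.
  disjointify : Violator A (λ x → 𝟙 (V x) * g x) (λ x → 𝟙 (V x) * f x) → DisjointViolator V A g f
  disjointify (S , T , viol) = record
    { S = S′ ; T = T′ ; S⊆V = λ _ → ∧-fst ; T⊆V = λ _ → ∧-fst
    ; disjoint = λ x → excl (V x) (S x) (T x)
    -- Adding `GT` to both sides lets `fg` compare the drops of the two vertex sums without
    -- subtraction.
    ; violates = +-cancelʳ-< GT _ _ (begin-strict
        F′ + E′ + GT     ≡⟨ swapʳ F′ E′ GT ⟩
        (F′ + GT) + E′   ≤⟨ +-mono-≤ fg edges ⟩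
        (F + GT′) + E    ≡⟨ rotate F GT′ E ⟩
        GT′ + (F + E)    <⟨ +-monoʳ-< GT′ viol ⟩
        GT′ + GT         ∎) }
    where
    open ≤-Reasoning
    swapʳ : ∀ p q r → p + q + r ≡ (p + r) + q
    swapʳ p q r = solve (p ∷ q ∷ r ∷ [])
    rotate : ∀ p q r → (p + q) + r ≡ q + (p + r)
    rotate p q r = solve (p ∷ q ∷ r ∷ [])
    S′ T′ : VSet n
    S′ x = V x ∧ (S x ∧ not (T x))
    T′ x = V x ∧ (T x ∧ not (S x))
    excl : ∀ v s t → v ∧ (s ∧ not t) ≡ true → v ∧ (t ∧ not s) ≡ false
    excl true true false _ = refl
    e e′ : Fin n → Fin n → ℕ
    e x y = 𝟙 (T x ∧ not (S y) ∧ A x y)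
    e′ x y = 𝟙 (T′ x ∧ not (S′ y) ∧ A x y)
    F F′ E E′ GT GT′ : ℕ
    F = sum (λ y → 𝟙 (S y) * (𝟙 (V y) * f y))
    F′ = sum (λ y → 𝟙 (S′ y) * f y)
    E = sum (λ x → sum (e x))
    E′ = sum (λ x → sum (e′ x))
    GT = sum (λ x → 𝟙 (T x) * (𝟙 (V x) * g x))
    GT′ = sum (λ x → 𝟙 (T′ x) * g x)
    pointwise : ∀ x → 𝟙 (S′ x) * f x + 𝟙 (T x) * (𝟙 (V x) * g x) ≤ 𝟙 (S x) * (𝟙 (V x) * f x) + 𝟙 (T′ x) * g x
    pointwise x with V x | S x | T x
    ... | false | _ | false = z≤n
    ... | false | _ | true = z≤n
    ... | true | false | false = z≤n
    ... | true | true | false = m≤m+n _ 0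
    ... | true | false | true = ≤-reflexive (+-identityʳ _)
    ... | true | true | true = m≤n⇒m≤n+o 0 (+-monoˡ-≤ 0 (+-monoˡ-≤ 0 (g≤f x)))
    fg : F′ + GT ≤ F + GT′
    fg = subst₂ _≤_ (∑-distrib-+ (λ x → 𝟙 (S′ x) * f x) _) (∑-distrib-+ (λ x → 𝟙 (S x) * (𝟙 (V x) * f x)) _) (sum-mono-≤ pointwise)
    ∧-false : ∀ p q → p ∧ q ∧ false ≡ false
    ∧-false false q = refl
    ∧-false true false = refl
    ∧-false true true = refl
    cell : ∀ x y → e′ x y + e′ y x ≤ e x y + e y x
    cell x y rewrite A-sym y x with A x y in Axy
    ... | false rewrite ∧-false (T′ x) (not (S′ y)) | ∧-false (T′ y) (not (S′ x)) = z≤n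
    ... | true rewrite A⊆V x y Axy | A⊆V y x (trans (A-sym y x) Axy) = swap-cell (S x) (T x) (S y) (T y)
    m+m≤n+n⇒m≤n : ∀ {p q} → p + p ≤ q + q → p ≤ q
    m+m≤n+n⇒m≤n {p} {q} le = ≮⇒≥ (λ q<p → <⇒≱ (+-mono-< q<p q<p) le)
    edges : E′ ≤ E
    -- Only the sum of a cell and its mirror image is controlled, so the inequality is first
    -- obtained for the doubled totals.
    edges = m+m≤n+n⇒m≤n (subst₂ _≤_ (sum-symmetrise e′) (sum-symmetrise e) (sum-mono-≤ (λ x → sum-mono-≤ (cell x))))

  -- An edge gets the mean of its two entries in `h`, so the sum at `x` is the mean of `row h x` and
  -- `col h x`, both within the required bounds when `x` is in `V`.
  average : ∃ (Factor A (λ x → 𝟙 (V x) * g x) (λ x → 𝟙 (V x) * f x)) → FracFactor V A g f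
  average (h , (h⊆A , r≤f , c≤f) , g≤r , g≤c) =
    (λ x y → half (w x y)) ,
    (λ x y → cong half (+-comm (𝟙 (h x y)) _)) ,
    (λ x y _ → half-mono {0} {w x y} z≤n , half-mono {w x y} {2} (+-mono-≤ (𝟙≤1 (h x y)) (𝟙≤1 (h y x)))) ,
    λ x Vx → subst₂ ℚ._≤_ (sym (fromℕℚ≡half (g x))) (sym (total x)) (half-mono (+-mono-≤ (inV g Vx (g≤r x)) (inV g Vx (g≤c x)))) ,
             subst₂ ℚ._≤_ (sym (total x)) (sym (fromℕℚ≡half (f x))) (half-mono (+-mono-≤ (inV′ f Vx (r≤f x)) (inV′ f Vx (c≤f x))))
    where
    w : Fin n → Fin n → ℕ
    w x y = 𝟙 (h x y) + 𝟙 (h y x)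
    𝟙≤1 : ∀ b → 𝟙 b ≤ 1
    𝟙≤1 false = z≤n
    𝟙≤1 true = ≤-refl
    onV : ∀ (u : Fin n → ℕ) {x} → V x ≡ true → 𝟙 (V x) * u x ≡ u x
    onV u {x} Vx rewrite Vx = +-identityʳ (u x)
    inV : ∀ (u : Fin n → ℕ) {x k} → V x ≡ true → 𝟙 (V x) * u x ≤ k → u x ≤ k
    inV u Vx = subst (_≤ _) (onV u Vx)
    inV′ : ∀ (u : Fin n → ℕ) {x k} → V x ≡ true → k ≤ 𝟙 (V x) * u x → k ≤ u x
    inV′ u Vx = subst (_ ≤_) (onV u Vx)
    support : ∀ x y → (if A x y then half (w x y) else 0ℚ) ≡ half (w x y)
    support x y with A x y in Axy
    ... | true = refl
    ... | false with h x y in hxy | h y x in hyx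
    ...   | false | false = refl
    ...   | true | _ with () ← trans (sym Axy) (h⊆A x y hxy)
    support x y | false | false | true with () ← trans (sym Axy) (trans (A-sym x y) (h⊆A y x hyx))
    total : ∀ x → sumℚ (map (λ y → if A x y then half (w x y) else 0ℚ) (allFin n)) ≡ half (row h x + col h x)
    total x = trans (sumℚ-half _ (w x) (support x)) (cong half (∑-distrib-+ (λ y → 𝟙 (h x y)) _))

  fracFactor-or-violator : FracFactor V A g f ⊎ DisjointViolator V A g f
  fracFactor-or-violator with factor-or-violator A A-sym (λ x → 𝟙 (V x) * g x) (λ x → 𝟙 (V x) * f x) (λ x → *-monoʳ-≤ (𝟙 (V x)) (g≤f x))
  ... | inj₁ F = inj₁ (average F)
  ... | inj₂ v = inj₂ (disjointify v)

-- The numerical contradictions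

module _ where
  open ≤-Reasoning

  -- Every vertex of `T` has degree at least `B + k`. The degree condition gives `m ≤ k + s`, so the
  -- loss `r * m` is covered by the surplus `t * k` together with `c * s`; this uses `r ≤ t` for the
  -- first part and `r ≤ c` for the second.
  no-violation-high : ∀ B b c s t k m r {d₁ Σd Σh} → d₁ ≡ B + k → 0 < c → c ≤ b → r ≤ t → r ≤ c →
    b * B + m * c ≤ (d₁ + s) * c → c * s + Σh < t * B →
    t * d₁ ≤ Σd → Σd ≤ Σh + r * m → ⊥
  no-violation-high B b c s t k m r {Σd = Σd} {Σh} refl 0<c c≤b r≤t r≤c degree violates low loss =
    <-irrefl refl (+-cancelʳ-< (t * B + Σh) (t * k + c * s) (t * k + c * s) (begin-strict
      t * k + c * s + (t * B + Σh)        ≡⟨ solve (t ∷ k ∷ c ∷ s ∷ B ∷ Σh ∷ []) ⟩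
      t * (B + k) + (c * s + Σh)          <⟨ +-monoʳ-< (t * (B + k)) violates ⟩
      t * (B + k) + t * B                 ≤⟨ +-monoˡ-≤ (t * B) (≤-trans low loss) ⟩
      Σh + r * m + t * B                  ≤⟨ +-monoˡ-≤ (t * B) (+-monoʳ-≤ Σh (*-monoʳ-≤ r m≤k+s)) ⟩
      Σh + r * (k + s) + t * B            ≡⟨ solve (Σh ∷ r ∷ k ∷ s ∷ t ∷ B ∷ []) ⟩
      r * k + r * s + (t * B + Σh)        ≤⟨ +-monoˡ-≤ (t * B + Σh) (+-mono-≤ (*-monoˡ-≤ k r≤t) (*-monoˡ-≤ s r≤c)) ⟩
      t * k + c * s + (t * B + Σh)        ∎))
    where
    m≤k+s : m ≤ k + s
    m≤k+s = +-cancelˡ-≤ B m (k + s) (*-cancelʳ-≤ (B + m) (B + (k + s)) c {{>-nonZero 0<c}} (begin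
      (B + m) * c           ≡⟨ *-distribʳ-+ c B m ⟩
      B * c + m * c         ≤⟨ +-monoˡ-≤ (m * c) (*-monoʳ-≤ B c≤b) ⟩
      B * b + m * c         ≡⟨ cong (_+ m * c) (*-comm B b) ⟩
      b * B + m * c         ≤⟨ degree ⟩
      (B + k + s) * c       ≡⟨ cong (_* c) (+-assoc B k s) ⟩
      (B + (k + s)) * c     ∎))

  -- The `p` near vertices fall short of `B` by at most `e` each and the other `q` not at all, so
  -- `c * s < p * e + 2 * m`. With the degree condition this leaves `b * e < suc d₁ * e`, impossible
  -- as `suc d₁ ≤ B ≤ b`.
  no-violation-clique : ∀ b c d₁ e s p q m {B Σh} → B ≡ d₁ + e → 0 < e → 2 ≤ c → c ≤ b → B ≤ b → p ≤ suc d₁ →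
    b * B + m * c ≤ (d₁ + s) * c → c * s + Σh < (p + q) * B →
    p * d₁ + q * B ≤ Σh + 2 * m → ⊥
  no-violation-clique b c d₁ e s p q m {Σh = Σh} refl 0<e 2≤c c≤b B≤b p≤ degree violates loss =
    <-irrefl refl (begin-strict
      b * e           <⟨ be<pe ⟩
      suc d₁ * e      ≤⟨ *-monoˡ-≤ e (≤-trans (≤-trans (≤-reflexive (+-comm 1 d₁)) (+-monoʳ-≤ d₁ 0<e)) B≤b) ⟩
      b * e           ∎)
    where
    cs<pe+2m : c * s < p * e + 2 * m
    cs<pe+2m = +-cancelʳ-< (p * d₁ + q * (d₁ + e) + Σh) (c * s) (p * e + 2 * m) (begin-strict
      c * s + (p * d₁ + q * (d₁ + e) + Σh)           ≡⟨ solve (c ∷ s ∷ p ∷ d₁ ∷ q ∷ e ∷ Σh ∷ []) ⟩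
      p * d₁ + q * (d₁ + e) + (c * s + Σh)           <⟨ +-mono-≤-< loss violates ⟩
      Σh + 2 * m + (p + q) * (d₁ + e)                ≡⟨ solve (m ∷ p ∷ d₁ ∷ q ∷ e ∷ Σh ∷ []) ⟩
      p * e + 2 * m + (p * d₁ + q * (d₁ + e) + Σh)   ∎)
    be<pe : b * e < suc d₁ * e
    be<pe = +-cancelʳ-< (b * d₁ + m * c) (b * e) (suc d₁ * e) (begin-strict
      b * e + (b * d₁ + m * c)            ≡⟨ solve (b ∷ e ∷ d₁ ∷ m ∷ c ∷ []) ⟩
      b * (d₁ + e) + m * c                ≤⟨ degree ⟩
      (d₁ + s) * c                        ≡⟨ solve (d₁ ∷ s ∷ c ∷ []) ⟩
      c * d₁ + c * s                      <⟨ +-monoʳ-< (c * d₁) cs<pe+2m ⟩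
      c * d₁ + (p * e + 2 * m)            ≤⟨ +-mono-≤ (*-monoˡ-≤ d₁ c≤b) (+-mono-≤ (*-monoˡ-≤ e p≤) (*-monoˡ-≤ m 2≤c)) ⟩
      b * d₁ + (suc d₁ * e + c * m)       ≡⟨ solve (b ∷ e ∷ d₁ ∷ m ∷ c ∷ []) ⟩
      suc d₁ * e + (b * d₁ + m * c)       ∎)

  -- The case `D = 0`. Bounding `t` by `n - i - s` gives `(c + B) * s + B * i < n * B`. Multiplied
  -- by `K` and combined with the bounds on `s + i` and `i`, this contradicts the identity
  -- `B * K + c * c = (c + B) * (c + B)`.
  no-violation-isolated : ∀ B c s t i n {K} → 0 < c → K ≡ c + B + c →
    c * s < t * B → i + s + t ≤ n → (c + B) * n ≤ (s + i) * K → i * K ≤ c * n → ⊥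
  no-violation-isolated B c@(suc _) s t i n {K} _ refl violates fits nonadjacent independent =
    <-irrefl refl (+-cancelʳ-< (B * (i * K)) _ _ (begin-strict
      (c + B) * ((c + B) * n) + B * (i * K)          ≤⟨ +-monoˡ-≤ (B * (i * K)) (*-monoʳ-≤ (c + B) nonadjacent) ⟩
      (c + B) * ((s + i) * K) + B * (i * K)          ≡⟨ expand c B s i K ⟩
      (c * s + (i + s) * B) * K + (c + B) * (i * K)  <⟨ +-monoˡ-< _ (*-monoˡ-< K bound) ⟩
      (n * B) * K + (c + B) * (i * K)                ≡⟨ split n B K c i ⟩
      (n * B) * K + c * (i * K) + B * (i * K)        ≤⟨ +-monoˡ-≤ (B * (i * K)) (+-monoʳ-≤ (n * B * K) (*-monoʳ-≤ c independent)) ⟩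
      (n * B) * K + c * (c * n) + B * (i * K)        ≡⟨ cong (_+ B * (i * K)) (square n B c) ⟩
      (c + B) * ((c + B) * n) + B * (i * K)          ∎))
    where
    expand : ∀ c B s i K → (c + B) * ((s + i) * K) + B * (i * K) ≡ (c * s + (i + s) * B) * K + (c + B) * (i * K)
    expand c B s i K = solve (c ∷ B ∷ s ∷ i ∷ K ∷ [])
    split : ∀ n B K c i → (n * B) * K + (c + B) * (i * K) ≡ (n * B) * K + c * (i * K) + B * (i * K)
    split n B K c i = solve (n ∷ B ∷ K ∷ c ∷ i ∷ [])
    square : ∀ n B c → (n * B) * (c + B + c) + c * (c * n) ≡ (c + B) * ((c + B) * n)
    square n B c = solve (n ∷ B ∷ c ∷ [])
    bound : c * s + (i + s) * B < n * B
    bound = begin-strict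
      c * s + (i + s) * B     <⟨ +-monoˡ-< ((i + s) * B) violates ⟩
      t * B + (i + s) * B     ≡⟨ solve (t ∷ B ∷ i ∷ s ∷ []) ⟩
      (i + s + t) * B         ≤⟨ *-monoˡ-≤ B fits ⟩
      n * B                   ∎

  -- Separately `d ≤ d * d` and `2 * j ≤ j * j + 1`. Equality occurs at `d = 0`, `j = 1`, so the
  -- contradiction drawn from it has no slack.
  d+2j≤ : ∀ d j → d + 2 * j ≤ d * d + d * j + j * j + 1
  d+2j≤ d j = begin
    d + 2 * j                    ≤⟨ +-mono-≤ (d≤dd d) (2j≤ j) ⟩
    d * d + (j * j + 1)          ≤⟨ m≤m+n _ (d * j) ⟩
    d * d + (j * j + 1) + d * j  ≡⟨ solve (d ∷ j ∷ []) ⟩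
    d * d + d * j + j * j + 1    ∎
    where
    d≤dd : ∀ d → d ≤ d * d
    d≤dd zero = z≤n
    d≤dd d@(suc _) = m≤m*n d d
    2j≤ : ∀ j → 2 * j ≤ j * j + 1
    2j≤ zero = z≤n
    2j≤ (suc k) = begin
      2 * suc k              ≤⟨ m≤m+n _ (k * k) ⟩
      2 * suc k + k * k      ≡⟨ solve (k ∷ []) ⟩
      suc k * suc k + 1      ∎

  -- Near vertices fall short of `B` by at most `j + e`, far ones by at most `e`. Eliminating
  -- `p + q`, then `s` and `i`, then `n` leaves an inequality in `d₁` and `j` that contradicts
  -- `d+2j≤`.
  no-violation-nonadjacent : ∀ c d₁ j e s p q i n m {D B K Σh} → D ≡ d₁ + j → B ≡ D + e → K ≡ c + B + c → 0 < D →
    p ≤ suc d₁ → c * s + Σh < (p + q) * B → p * d₁ + q * D ≤ Σh + 2 * m →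
    i + s + (p + q) ≤ n → (c + B) * n ≤ (D + s + i) * K → i * K ≤ c * n →
    (c + B + 2 * m) * K < n * c + K → ⊥
  no-violation-nonadjacent c d₁ j e s p q i n m {D@(suc D-1)} {K = K} {Σh} D≡ refl K≡ _ p≤ violates loss fits nonadjacent independent large =
    <-irrefl refl (<-≤-trans final (d+2j≤ d₁ j))
    where
    R : ℕ
    -- The extra shortfall `j` of at most `suc d₁` near vertices, plus both ends of each deleted
    -- edge.
    R = suc d₁ * j + 2 * m
    step₁ : c * s < (p + q) * e + p * j + 2 * m
    step₁ = +-cancelʳ-< (p * d₁ + q * D + Σh) (c * s) _ (begin-strict
      c * s + (p * d₁ + q * D + Σh)                             ≡⟨ rearrange (c * s) (p * d₁ + q * D) Σh ⟩
      p * d₁ + q * D + (c * s + Σh)                             <⟨ +-mono-≤-< loss violates ⟩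
      Σh + 2 * m + (p + q) * (D + e)                            ≡⟨ cong (λ z → Σh + 2 * m + (p + q) * (z + e)) D≡ ⟩
      Σh + 2 * m + (p + q) * (d₁ + j + e)                       ≡⟨ solve (Σh ∷ m ∷ p ∷ q ∷ d₁ ∷ j ∷ e ∷ []) ⟩
      (p + q) * e + p * j + 2 * m + (p * d₁ + q * (d₁ + j) + Σh) ≡⟨ cong (λ z → (p + q) * e + p * j + 2 * m + (p * d₁ + q * z + Σh)) (sym D≡) ⟩
      (p + q) * e + p * j + 2 * m + (p * d₁ + q * D + Σh)       ∎)
      where
      rearrange : ∀ x y z → x + (y + z) ≡ y + (x + z)
      rearrange x y z = solve (x ∷ y ∷ z ∷ [])
    -- Here `p + q` is bounded by `n - i - s`, which moves `(i + s) * e` to the left.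
    step₂ : (c + e) * s + e * i < n * e + R
    step₂ = begin-strict
      (c + e) * s + e * i                                    ≡⟨ solve (c ∷ e ∷ s ∷ i ∷ []) ⟩
      c * s + (i + s) * e                                    <⟨ +-monoˡ-< ((i + s) * e) step₁ ⟩
      (p + q) * e + p * j + 2 * m + (i + s) * e              ≡⟨ solve (p ∷ q ∷ e ∷ j ∷ m ∷ i ∷ s ∷ []) ⟩
      (i + s + (p + q)) * e + (p * j + 2 * m)                ≤⟨ +-mono-≤ (*-monoˡ-≤ e fits) (+-monoˡ-≤ (2 * m) (*-monoˡ-≤ j p≤)) ⟩
      n * e + R                                              ∎
    -- The strictness of `step₂`, multiplied by `K`, supplies the summand `K`. Since `K` is
    -- `2 * c + D + e`, all multiples of `n` cancel except `c * D * n`.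
    step₃ : c * D * n + K ≤ ((c + e) * D + R) * K
    step₃ = +-cancelʳ-≤ (e * (i * K) + n * e * K + c * (c * n)) _ _ (begin
      c * D * n + K + (e * (i * K) + n * e * K + c * (c * n))
        ≡⟨ cong (λ z → c * D * n + K + (e * (i * K) + n * e * z + c * (c * n))) K≡ ⟩
      c * D * n + K + (e * (i * K) + n * e * (c + (D + e) + c) + c * (c * n))
        ≡⟨ collect c D e n (i * K) K ⟩
      (c + e) * ((c + (D + e)) * n) + (e * (i * K) + K)
        ≤⟨ +-monoˡ-≤ _ (*-monoʳ-≤ (c + e) nonadjacent) ⟩
      (c + e) * ((D + s + i) * K) + (e * (i * K) + K)
        ≡⟨ regroup c e D s i K ⟩
      (c + e) * (D * K) + c * (i * K) + e * (i * K) + suc ((c + e) * s + e * i) * K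
        ≤⟨ +-mono-≤ (+-monoˡ-≤ (e * (i * K)) (+-monoʳ-≤ ((c + e) * (D * K)) (*-monoʳ-≤ c independent))) (*-monoˡ-≤ K step₂) ⟩
      (c + e) * (D * K) + c * (c * n) + e * (i * K) + (n * e + R) * K
        ≡⟨ finish c e D K (c * (c * n)) (e * (i * K)) (n * e) R ⟩
      ((c + e) * D + R) * K + (e * (i * K) + n * e * K + c * (c * n)) ∎)
      where
      collect : ∀ c D e n x K → c * D * n + K + (e * x + n * e * (c + (D + e) + c) + c * (c * n))
        ≡ (c + e) * ((c + (D + e)) * n) + (e * x + K)
      collect c D e n x K = solve (c ∷ D ∷ e ∷ n ∷ x ∷ K ∷ [])
      regroup : ∀ c e D s i K → (c + e) * ((D + s + i) * K) + (e * (i * K) + K)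
        ≡ (c + e) * (D * K) + c * (i * K) + e * (i * K) + suc ((c + e) * s + e * i) * K
      regroup c e D s i K = solve (c ∷ e ∷ D ∷ s ∷ i ∷ K ∷ [])
      finish : ∀ c e D K x y z R → (c + e) * (D * K) + x + y + (z + R) * K ≡ ((c + e) * D + R) * K + (y + z * K + x)
      finish c e D K x y z R = solve (c ∷ e ∷ D ∷ K ∷ x ∷ y ∷ z ∷ R ∷ [])
    -- The lower bound on `n`, multiplied by `D`, removes `n`; then the factor `K` cancels.
    step₄ : D * (c + (D + e) + 2 * m) + 1 < (c + e) * D + R + D
    step₄ = *-cancelʳ-< K _ _ (begin-strict
      (D * (c + (D + e) + 2 * m) + 1) * K                  ≡⟨ distribute D (c + (D + e) + 2 * m) K ⟩
      D * ((c + (D + e) + 2 * m) * K) + K                  <⟨ +-monoˡ-< K (*-monoʳ-< D large) ⟩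
      D * (n * c + K) + K                                  ≡⟨ commute D n c K ⟩
      c * D * n + K + D * K                                ≤⟨ +-monoˡ-≤ (D * K) step₃ ⟩
      ((c + e) * D + R) * K + D * K                        ≡⟨ sym (*-distribʳ-+ K ((c + e) * D + R) D) ⟩
      ((c + e) * D + R + D) * K                            ∎)
      where
      distribute : ∀ x y z → (x * y + 1) * z ≡ x * (y * z) + z
      distribute x y z = solve (x ∷ y ∷ z ∷ [])
      commute : ∀ D n c K → D * (n * c + K) + K ≡ c * D * n + K + D * K
      commute D n c K = solve (D ∷ n ∷ c ∷ K ∷ [])
    final : suc (d₁ * d₁ + d₁ * j + j * j + 1) ≤ d₁ + 2 * j
    final = +-cancelʳ-≤ ((c + e) * D + 2 * m + d₁ * j) _ _ (begin
      suc (d₁ * d₁ + d₁ * j + j * j + 1) + ((c + e) * D + 2 * m + d₁ * j)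
        ≡⟨ binomial d₁ j ((c + e) * D) (2 * m) ⟩
      suc ((c + e) * D + (d₁ + j) * (d₁ + j) + 2 * m + 1)
        ≡⟨ cong (λ z → suc ((c + e) * D + z * z + 2 * m + 1)) (sym D≡) ⟩
      suc ((c + e) * D + D * D + 2 * m + 1)
        -- `D ≥ 1` enters here as `2 * m ≤ 2 * m * D`.
        ≤⟨ s≤s (+-monoˡ-≤ 1 (+-monoʳ-≤ _ (m≤m*n (2 * m) D))) ⟩
      suc ((c + e) * D + D * D + 2 * m * D + 1)
        ≡⟨ cong suc (factor c e D m) ⟩
      suc (D * (c + (D + e) + 2 * m) + 1)
        ≤⟨ step₄ ⟩
      (c + e) * D + R + D
        ≡⟨ cong ((c + e) * D + R +_) D≡ ⟩
      (c + e) * D + (suc d₁ * j + 2 * m) + (d₁ + j)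
        ≡⟨ tidy ((c + e) * D) d₁ j m ⟩
      d₁ + 2 * j + ((c + e) * D + 2 * m + d₁ * j) ∎)
      where
      binomial : ∀ d j x y → suc (d * d + d * j + j * j + 1) + (x + y + d * j) ≡ suc (x + (d + j) * (d + j) + y + 1)
      binomial d j x y = solve (d ∷ j ∷ x ∷ y ∷ [])
      factor : ∀ c e D m → (c + e) * D + D * D + 2 * m * D + 1 ≡ D * (c + (D + e) + 2 * m) + 1
      factor c e D m = solve (c ∷ e ∷ D ∷ m ∷ [])
      tidy : ∀ x d j m → x + (suc d * j + 2 * m) + (d + j) ≡ d + 2 * j + (x + 2 * m + d * j)
      tidy x d j m = solve (x ∷ d ∷ j ∷ m ∷ [])

-- Counting in G - I - H

size : ∀ {n} → VSet n → ℕ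
size X = sum (λ x → 𝟙 (X x))

member≤sum : ∀ {n} (u : Fin n → ℕ) k → u k ≤ sum u
member≤sum u zero = m≤m+n _ _
member≤sum u (suc k) = ≤-trans (member≤sum (u ∘ suc) k) (m≤n+m _ _)

sum-one : ∀ n → sum {n} (λ _ → 1) ≡ n
sum-one zero = refl
sum-one (suc n) = cong suc (sum-one n)

sum-𝟙-≤ : ∀ {n} (X : VSet n) (u : Fin n → ℕ) k → (∀ x → X x ≡ true → u x ≤ k) →
  sum (λ x → 𝟙 (X x) * u x) ≤ size X * k
sum-𝟙-≤ X u k u≤k = ≤-trans (sum-mono-≤ le) (≤-reflexive (sym (*-distribʳ-sum k (λ x → 𝟙 (X x)))))
  where
  le : ∀ x → 𝟙 (X x) * u x ≤ 𝟙 (X x) * k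
  le x with X x in Xx
  ... | false = z≤n
  ... | true = +-monoˡ-≤ 0 (u≤k x Xx)

sum-𝟙-≥ : ∀ {n} (X : VSet n) (u : Fin n → ℕ) k → (∀ x → X x ≡ true → k ≤ u x) →
  size X * k ≤ sum (λ x → 𝟙 (X x) * u x)
sum-𝟙-≥ X u k k≤u = ≤-trans (≤-reflexive (*-distribʳ-sum k (λ x → 𝟙 (X x)))) (sum-mono-≤ le)
  where
  le : ∀ x → 𝟙 (X x) * k ≤ 𝟙 (X x) * u x
  le x with X x in Xx
  ... | false = z≤n
  ... | true = +-monoˡ-≤ 0 (k≤u x Xx)

argmin : ∀ {n} (X : VSet n) (d : Fin n → ℕ) →
  (∀ x → X x ≡ false) ⊎ (Σ (Fin n) λ x → X x ≡ true × (∀ y → X y ≡ true → d x ≤ d y))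
argmin {zero} X d = inj₁ λ ()
argmin {suc n} X d with argmin (X ∘ suc) (d ∘ suc) | X zero in X0
... | inj₁ none | false = inj₁ λ { zero → X0 ; (suc x) → none x }
... | inj₁ none | true = inj₂ (zero , X0 , λ { zero _ → ≤-refl ; (suc y) Xy → ⊥-elim (not-¬ (none y) Xy) })
... | inj₂ (x , Xx , low) | false = inj₂ (suc x , Xx , λ { zero p → ⊥-elim (not-¬ X0 p) ; (suc y) Xy → low y Xy })
... | inj₂ (x , Xx , low) | true with ≤-total (d zero) (d (suc x))
...   | inj₁ le = inj₂ (zero , X0 , λ { zero _ → ≤-refl ; (suc y) Xy → ≤-trans le (low y Xy) })
...   | inj₂ ge = inj₂ (suc x , Xx , λ { zero _ → ge ; (suc y) Xy → low y Xy })

listSum-concatMap : ∀ {n} (F : Fin n → List ℕ) →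
  ListAction.sum (concatMap F (allFin n)) ≡ sum (λ x → ListAction.sum (F x))
listSum-concatMap F = trans (cong (ListAction.sum ∘ concat) (map-tabulate id F)) (tab F)
  where
  tab : ∀ {n} (F : Fin n → List ℕ) → ListAction.sum (concat (tabulate F)) ≡ sum (λ x → ListAction.sum (F x))
  tab {zero} F = refl
  tab {suc n} F = trans (sum-++ (F zero) _) (cong (ListAction.sum (F zero) +_) (tab (F ∘ suc)))

-- Each edge is counted once by edgeCount, through its orientation from the smaller to the larger end.
module _ {n : ℕ} (H : Fin n → Fin n → Bool) (H-sym : ∀ x y → H x y ≡ H y x) (H-irref : ∀ x → H x x ≡ false) where

  oriented : Fin n → Fin n → Bool
  oriented x y = (toℕ x <ᵇ toℕ y) ∧ H x y

  edgeCount≡sum : edgeCount H ≡ sum (row oriented)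
  edgeCount≡sum = trans (listSum-concatMap (λ x → map (λ y → 𝟙 (oriented x y)) (allFin n)))
                    (sum-cong-≗ (λ x → listSum≡sum (λ y → 𝟙 (oriented x y))))

  orient : ∀ x y → 𝟙 (H x y) ≡ 𝟙 (oriented x y) + 𝟙 (oriented y x)
  orient x y rewrite H-sym y x with toℕ x <ᵇ toℕ y in p | toℕ y <ᵇ toℕ x in q
  ... | true | false = sym (+-identityʳ _)
  ... | false | true = refl
  ... | true | true = ⊥-elim (<-asym (<ᵇ⇒< (toℕ x) (toℕ y) (subst IsTrue (sym p) _)) (<ᵇ⇒< (toℕ y) (toℕ x) (subst IsTrue (sym q) _)))
  ... | false | false rewrite toℕ-injective {i = x} {y} (≤-antisym
          (≮⇒≥ (λ lt → subst IsTrue q (<⇒<ᵇ lt))) (≮⇒≥ (λ lt → subst IsTrue p (<⇒<ᵇ lt)))) | H-irref y = refl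

  handshake : sum (row H) ≡ edgeCount H + edgeCount H
  handshake = trans (sum-cong-≗ (λ x → sum-cong-≗ (orient x)))
    (trans (sum-symmetrise (λ x y → 𝟙 (oriented x y))) (sym (cong₂ _+_ edgeCount≡sum edgeCount≡sum)))

  -- An edge at `x` lies either in the oriented row of `x` or in column `x` of another row. As the
  -- diagonal entry is zero, these are disjoint parts of the sum over all rows.
  degree≤edgeCount : ∀ x → row H x ≤ edgeCount H
  degree≤edgeCount x = begin
    row H x                                             ≡⟨ trans (sum-cong-≗ (orient x)) (∑-distrib-+ (λ y → 𝟙 (oriented x y)) _) ⟩
    row oriented x + col oriented x                     ≡⟨ cong (_+ col oriented x) (sym (trans (cong (_* row oriented x) (sum-δ x)) (*-identityˡ _))) ⟩
    sum (δ x) * row oriented x + col oriented x         ≡⟨ cong (_+ col oriented x) (*-distribʳ-sum (row oriented x) (δ x)) ⟩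
    sum (λ u → δ x u * row oriented x) + col oriented x ≡⟨ sym (∑-distrib-+ (λ u → δ x u * row oriented x) _) ⟩
    sum (λ u → δ x u * row oriented x + 𝟙 (oriented u x)) ≤⟨ sum-mono-≤ le ⟩
    sum (row oriented)                                  ≡⟨ sym edgeCount≡sum ⟩
    edgeCount H                                         ∎
    where
    open ≤-Reasoning
    loop : 𝟙 (oriented x x) ≡ 0
    loop rewrite H-irref x with toℕ x <ᵇ toℕ x
    ... | true = refl
    ... | false = refl
    le : ∀ u → δ x u * row oriented x + 𝟙 (oriented u x) ≤ row oriented u
    le u with x ≟F u
    ... | yes refl = ≤-reflexive (trans (cong₂ _+_ (*-identityˡ _) loop) (+-identityʳ _))
    ... | no _ = member≤sum (λ y → 𝟙 (oriented u y)) x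

deg≡row : ∀ {n} (G : Graph n) x → deg G x ≡ row (adj G) x
deg≡row G x = listSum≡sum (λ y → 𝟙 (adj G x y))

size≤1 : ∀ {n} (I : VSet n) → (∀ x y → I x ≡ true → I y ≡ true → x ≡ y) → size I ≤ 1
size≤1 {n} I unique with any? (λ x → I x ≟B true)
... | no none = ≤-trans (sum-mono-≤ (λ y → ≤-reflexive (cong 𝟙 (¬-not (λ Iy → none (y , Iy)))))) (≤-trans (≤-reflexive (sum-zero n)) z≤n)
... | yes (x , Ix) = ≤-trans (sum-mono-≤ le) (≤-reflexive (sum-δ x))
  where
  le : ∀ y → 𝟙 (I y) ≤ δ x y
  le y with I y in Iy
  ... | false = z≤n
  ... | true rewrite unique x y Ix Iy | δ-refl y = ≤-refl

Remaining : ∀ {n} → VSet n → VSet n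
Remaining I x = not (I x)

RemainingEdge : ∀ {n} → Graph n → VSet n → (Fin n → Fin n → Bool) → Fin n → Fin n → Bool
RemainingEdge G I H x y = adjMinus G I x y ∧ not (H x y)

module _ {n : ℕ} (G : Graph n) (I : VSet n) (H : Fin n → Fin n → Bool) (H⊆ : EdgeSubset H (adjMinus G I)) where

  remainingEdge-sym : ∀ x y → RemainingEdge G I H x y ≡ RemainingEdge G I H y x
  remainingEdge-sym x y rewrite proj₁ H⊆ x y | adj-sym G x y = cong (_∧ not (H y x)) (∧-swap (not (I x)) (not (I y)) (adj G y x))
    where
    ∧-swap : ∀ p q r → p ∧ (q ∧ r) ≡ q ∧ (p ∧ r)
    ∧-swap false false r = refl
    ∧-swap false true r = refl
    ∧-swap true false r = refl
    ∧-swap true true r = refl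

  remainingEdge⊆remaining : ∀ x y → RemainingEdge G I H x y ≡ true → Remaining I x ≡ true
  remainingEdge⊆remaining x y p with Remaining I x
  ... | true = refl

  H-irref : ∀ x → H x x ≡ false
  H-irref x = ¬-not λ Hxx → loop (proj₂ H⊆ x x Hxx)
    where
    loop : adjMinus G I x x ≢ true
    loop p rewrite irref G x with not (I x)
    loop () | false
    loop () | true

-- Excluding a violator by the degree conditions

module _ {n : ℕ} (G : Graph n) (b c B K m : ℕ) (2≤c : 2 ≤ c) (c≤b : c ≤ b) (B≤b : B ≤ b) (K≡ : K ≡ c + B + c)
  (minDegree : ∀ x → c * c * n + b * B * K + m * K * c ≤ deg G x * K * c)
  (large : (c + B + 2 * m) * K < n * c + K)
  (nonadjacent : ∀ x y → x ≢ y → adj G x y ≡ false → (c + B) * n ≤ (deg G x ⊔ deg G y) * K) where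

  0<c : 0 < c
  0<c = ≤-trans (s≤s z≤n) 2≤c

  0<K : 0 < K
  0<K = subst (0 <_) (sym K≡) (≤-trans 0<c (m≤n+m c (c + B)))

  module _ (I : VSet n) (indep : Independent G I) where

    degree+independent≤n : ∀ z → I z ≡ true → deg G z + size I ≤ n
    degree+independent≤n z Iz = begin
      deg G z + size I                         ≡⟨ cong (_+ size I) (deg≡row G z) ⟩
      row (adj G) z + size I                   ≡⟨ sym (∑-distrib-+ (λ y → 𝟙 (adj G z y)) _) ⟩
      sum (λ y → 𝟙 (adj G z y) + 𝟙 (I y))      ≤⟨ sum-mono-≤ le ⟩
      sum {n} (λ _ → 1)                        ≡⟨ sum-one n ⟩
      n                                        ∎
      where
      open ≤-Reasoning
      le : ∀ y → 𝟙 (adj G z y) + 𝟙 (I y) ≤ 1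
      le y with I y in Iy
      ... | true rewrite indep z y Iz Iy = ≤-refl
      ... | false with adj G z y
      ...   | true = ≤-refl
      ...   | false = z≤n

    independent-small-by : ∀ z → I z ≡ true → (c + B) * n ≤ deg G z * K → size I * K ≤ c * n
    independent-small-by z Iz le = +-cancelˡ-≤ ((c + B) * n) _ _ (begin
      (c + B) * n + size I * K      ≤⟨ +-monoˡ-≤ (size I * K) le ⟩
      deg G z * K + size I * K      ≡⟨ sym (*-distribʳ-+ K (deg G z) (size I)) ⟩
      (deg G z + size I) * K        ≤⟨ *-monoˡ-≤ K (degree+independent≤n z Iz) ⟩
      n * K                         ≡⟨ cong (n *_) K≡ ⟩
      n * (c + B + c)               ≡⟨ solve (n ∷ c ∷ B ∷ []) ⟩
      (c + B) * n + c * n           ∎)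
      where open ≤-Reasoning

    -- Of two distinct vertices of `I`, which are non-adjacent, one has at least `(c + B) * n / K`
    -- neighbours, all outside `I`; this leaves `c * n / K` vertices for `I`. Otherwise `I` has at
    -- most one vertex, and the lower bound on `n` gives `K ≤ c * n`.
    independent-small : size I * K ≤ c * n
    independent-small with any? (λ x → any? (λ y → (I x ≟B true) ×-dec (I y ≟B true) ×-dec ¬? (x ≟F y)))
    ... | yes (x , y , Ix , Iy , x≢y) with ⊔-sel (deg G x) (deg G y) | nonadjacent x y x≢y (indep x y Ix Iy)
    ...   | inj₁ e | le = independent-small-by x Ix (subst (λ z → (c + B) * n ≤ z * K) e le)
    ...   | inj₂ e | le = independent-small-by y Iy (subst (λ z → (c + B) * n ≤ z * K) e le)
    independent-small | no noPair = begin
      size I * K      ≤⟨ *-monoˡ-≤ K (size≤1 I unique) ⟩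
      1 * K           ≤⟨ <⇒≤ K<nc ⟩
      n * c           ≡⟨ *-comm n c ⟩
      c * n           ∎
      where
      open ≤-Reasoning
      unique : ∀ x y → I x ≡ true → I y ≡ true → x ≡ y
      unique x y Ix Iy with x ≟F y
      ... | yes x≡y = x≡y
      ... | no x≢y = ⊥-elim (noPair (x , y , Ix , Iy , x≢y))
      K<nc : 1 * K < n * c
      K<nc = +-cancelʳ-< K (1 * K) (n * c) (begin-strict
        1 * K + K               ≡⟨ solve (K ∷ []) ⟩
        2 * K                   ≤⟨ *-monoˡ-≤ K (≤-trans 2≤c (≤-trans (m≤m+n c B) (m≤m+n (c + B) (2 * m)))) ⟩
        (c + B + 2 * m) * K     <⟨ large ⟩
        n * c + K               ∎)

    module _ (g f : Fin n → ℕ) (c≤f : ∀ x → c ≤ f x) (g≤B : ∀ x → g x ≤ B)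
             (H : Fin n → Fin n → Bool) (H⊆ : EdgeSubset H (adjMinus G I)) (count : edgeCount H ≡ m) where

      no-violator : ¬ DisjointViolator (Remaining I) (RemainingEdge G I H) g f
      no-violator record { S = S ; T = T ; S⊆V = S⊆V ; T⊆V = T⊆V ; disjoint = disjoint ; violates = violates } = absurd-at (argmin T d)
        where
        open ≤-Reasoning
        i s t Σd Σh : ℕ
        d : Fin n → ℕ
        i = size I
        s = size S
        t = size T
        d x = sum (λ y → 𝟙 (not (I y) ∧ not (S y) ∧ adj G x y))
        Σd = sum (λ x → 𝟙 (T x) * d x)
        Σh = sum (λ x → sum (λ y → 𝟙 (T x ∧ not (S y) ∧ RemainingEdge G I H x y)))

        violation : c * s + Σh < t * B
        violation = begin-strict
          c * s + Σh                            ≡⟨ cong (_+ Σh) (*-comm c s) ⟩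
          s * c + Σh                            ≤⟨ +-monoˡ-≤ Σh (sum-𝟙-≥ S f c (λ x _ → c≤f x)) ⟩
          sum (λ y → 𝟙 (S y) * f y) + Σh        <⟨ violates ⟩
          sum (λ x → 𝟙 (T x) * g x)             ≤⟨ sum-𝟙-≤ T g B (λ x _ → g≤B x) ⟩
          t * B                                 ∎

        fits : i + s + t ≤ n
        fits = begin
          i + s + t                                     ≡⟨ cong (_+ t) (sym (∑-distrib-+ (λ x → 𝟙 (I x)) _)) ⟩
          sum (λ x → 𝟙 (I x) + 𝟙 (S x)) + t             ≡⟨ sym (∑-distrib-+ (λ x → 𝟙 (I x) + 𝟙 (S x)) _) ⟩
          sum (λ x → 𝟙 (I x) + 𝟙 (S x) + 𝟙 (T x))       ≤⟨ sum-mono-≤ le ⟩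
          sum {n} (λ _ → 1)                             ≡⟨ sum-one n ⟩
          n                                             ∎
          where
          le : ∀ x → 𝟙 (I x) + 𝟙 (S x) + 𝟙 (T x) ≤ 1
          le x with I x in Ix | S x in Sx | T x in Tx
          ... | true | true | _ with () ← trans (sym (cong not Ix)) (S⊆V x Sx)
          ... | true | false | true with () ← trans (sym (cong not Ix)) (T⊆V x Tx)
          ... | true | false | false = ≤-refl
          ... | false | true | true with () ← trans (sym Tx) (disjoint x Sx)
          ... | false | true | false = ≤-refl
          ... | false | false | true = ≤-refl
          ... | false | false | false = z≤n

        deg≤ : ∀ x → deg G x ≤ d x + s + i
        deg≤ x = begin
          deg G x                                                 ≡⟨ deg≡row G x ⟩
          row (adj G) x                                           ≤⟨ sum-mono-≤ le ⟩
          sum (λ y → 𝟙 (not (I y) ∧ not (S y) ∧ adj G x y) + 𝟙 (S y) + 𝟙 (I y))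
            ≡⟨ ∑-distrib-+ (λ y → 𝟙 (not (I y) ∧ not (S y) ∧ adj G x y) + 𝟙 (S y)) _ ⟩
          sum (λ y → 𝟙 (not (I y) ∧ not (S y) ∧ adj G x y) + 𝟙 (S y)) + i
            ≡⟨ cong (_+ i) (∑-distrib-+ (λ y → 𝟙 (not (I y) ∧ not (S y) ∧ adj G x y)) _) ⟩
          d x + s + i                                             ∎
          where
          le : ∀ y → 𝟙 (adj G x y) ≤ 𝟙 (not (I y) ∧ not (S y) ∧ adj G x y) + 𝟙 (S y) + 𝟙 (I y)
          le y with I y | S y | adj G x y
          ... | _ | _ | false = z≤n
          ... | true | true | true = s≤s z≤n
          ... | true | false | true = ≤-refl
          ... | false | true | true = ≤-refl
          ... | false | false | true = ≤-refl

        -- The term `c * c * n` of the minimum degree condition pays for the neighbours in `I`,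
        -- because `i * K ≤ c * n`.
        degree-bound : ∀ x → b * B + m * c ≤ (d x + s) * c
        degree-bound x = *-cancelʳ-≤ _ _ K {{>-nonZero 0<K}} (+-cancelʳ-≤ (c * c * n) _ _ (begin
          (b * B + m * c) * K + c * c * n             ≡⟨ shuffle (b * B) m c K n ⟩
          c * c * n + b * B * K + m * K * c           ≤⟨ minDegree x ⟩
          deg G x * K * c                             ≤⟨ *-monoˡ-≤ c (*-monoˡ-≤ K (deg≤ x)) ⟩
          (d x + s + i) * K * c                       ≡⟨ expand (d x + s) i K c ⟩
          (d x + s) * c * K + c * (i * K)             ≤⟨ +-monoʳ-≤ _ (*-monoʳ-≤ c independent-small) ⟩
          (d x + s) * c * K + c * (c * n)             ≡⟨ cong ((d x + s) * c * K +_) (sym (*-assoc c c n)) ⟩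
          (d x + s) * c * K + c * c * n               ∎))
          where
          shuffle : ∀ x m c K n → (x + m * c) * K + c * c * n ≡ c * c * n + x * K + m * K * c
          shuffle x m c K n = solve (x ∷ m ∷ c ∷ K ∷ n ∷ [])
          expand : ∀ x i K c → (x + i) * K * c ≡ x * c * K + c * (i * K)
          expand x i K c = solve (x ∷ i ∷ K ∷ c ∷ [])

        -- An edge counted in `d x` but absent from `Σh` was deleted and is charged to the degree of
        -- `x` in `H`.
        Σd≤ : Σd ≤ Σh + sum (λ x → 𝟙 (T x) * row H x)
        Σd≤ = ≤-trans (sum-mono-≤ perVertex) (≤-reflexive (∑-distrib-+ (λ x → sum (λ y → 𝟙 (T x ∧ not (S y) ∧ RemainingEdge G I H x y))) _))
          where
          edge : ∀ i′ s′ a′ h′ → 𝟙 (i′ ∧ s′ ∧ a′) ≤ 𝟙 (s′ ∧ (i′ ∧ a′) ∧ not h′) + 𝟙 h′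
          edge false _ _ _ = z≤n
          edge true false _ _ = z≤n
          edge true true false _ = z≤n
          edge true true true false = ≤-refl
          edge true true true true = ≤-refl
          perVertex : ∀ x → 𝟙 (T x) * d x ≤ sum (λ y → 𝟙 (T x ∧ not (S y) ∧ RemainingEdge G I H x y)) + 𝟙 (T x) * row H x
          perVertex x with T x in Tx
          ... | false = z≤n
          ... | true rewrite T⊆V x Tx | +-identityʳ (d x) | +-identityʳ (row H x) =
                  ≤-trans (sum-mono-≤ (λ y → edge (not (I y)) (not (S y)) (adj G x y) (H x y)))
                    (≤-reflexive (∑-distrib-+ (λ y → 𝟙 (not (S y) ∧ (not (I y) ∧ adj G x y) ∧ not (H x y))) _))

        loss-t : sum (λ x → 𝟙 (T x) * row H x) ≤ t * m
        loss-t = sum-𝟙-≤ T (row H) m (λ x _ → subst (row H x ≤_) count (degree≤edgeCount H (proj₁ H⊆) (H-irref G I H H⊆) x))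

        loss-2 : sum (λ x → 𝟙 (T x) * row H x) ≤ 2 * m
        loss-2 = begin
          sum (λ x → 𝟙 (T x) * row H x)     ≤⟨ sum-mono-≤ drop ⟩
          sum (row H)                       ≡⟨ handshake H (proj₁ H⊆) (H-irref G I H H⊆) ⟩
          edgeCount H + edgeCount H         ≡⟨ cong₂ _+_ count count ⟩
          m + m                             ≡⟨ cong (m +_) (sym (+-identityʳ m)) ⟩
          2 * m                             ∎
          where
          drop : ∀ x → 𝟙 (T x) * row H x ≤ row H x
          drop x with T x
          ... | false = z≤n
          ... | true = ≤-reflexive (*-identityˡ _)

        -- Each vertex loses at most `m` edges, all together at most `2 * m`. The minimum is kept
        -- for the sake of a one-vertex `T`.
        loss : Σd ≤ Σh + (t ⊓ 2) * m
        loss = ≤-trans Σd≤ (+-monoʳ-≤ Σh (subst (_ ≤_) (sym (*-distribʳ-⊓ m t 2)) (⊓-glb loss-t loss-2)))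

        loss₂ : Σd ≤ Σh + 2 * m
        loss₂ = ≤-trans Σd≤ (+-monoʳ-≤ Σh loss-2)

        module _ (x₁ : Fin n) (x₁-min : ∀ y → T y ≡ true → d x₁ ≤ d y) where

          N Near Far : VSet n
          N x = does (x₁ ≟F x) ∨ adj G x₁ x
          Near x = T x ∧ N x
          Far x = T x ∧ not (N x)

          p q : ℕ
          p = size Near
          q = size Far

          p+q≡t : p + q ≡ t
          p+q≡t = trans (sym (∑-distrib-+ (λ x → 𝟙 (Near x)) _)) (sum-cong-≗ (λ x → eq (T x) (N x)))
            where
            eq : ∀ u v → 𝟙 (u ∧ v) + 𝟙 (u ∧ not v) ≡ 𝟙 u
            eq false v = refl
            eq true false = refl
            eq true true = refl

          violation′ : c * s + Σh < (p + q) * B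
          violation′ = subst (λ z → c * s + Σh < z * B) (sym p+q≡t) violation

          -- `T` avoids `I` and `S`, so near vertices other than `x₁` are neighbours of `x₁` counted
          -- in `d x₁`.
          p≤ : p ≤ suc (d x₁)
          p≤ = begin
            p                                                                     ≤⟨ sum-mono-≤ le ⟩
            sum (λ x → δ x₁ x + 𝟙 (not (I x) ∧ not (S x) ∧ adj G x₁ x))           ≡⟨ ∑-distrib-+ (δ x₁) _ ⟩
            sum (δ x₁) + d x₁                                                     ≡⟨ cong (_+ d x₁) (sum-δ x₁) ⟩
            suc (d x₁)                                                            ∎
            where
            S-false : ∀ {x} → T x ≡ true → S x ≡ false
            S-false {x} Tx = ¬-not λ Sx → not-¬ Tx (disjoint x Sx)
            le : ∀ x → 𝟙 (Near x) ≤ δ x₁ x + 𝟙 (not (I x) ∧ not (S x) ∧ adj G x₁ x)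
            le x with T x in Tx
            ... | false = z≤n
            ... | true rewrite S-false Tx | T⊆V x Tx with does (x₁ ≟F x)
            ...   | true = s≤s z≤n
            ...   | false = ≤-refl

          split : ∀ D → (∀ x → Far x ≡ true → D ≤ d x) → p * d x₁ + q * D ≤ Σd
          split D D≤ = begin
            p * d x₁ + q * D
              ≤⟨ +-mono-≤ (sum-𝟙-≥ Near d (d x₁) (λ x Nx → x₁-min x (∧-fst Nx))) (sum-𝟙-≥ Far d D D≤) ⟩
            sum (λ x → 𝟙 (Near x) * d x) + sum (λ x → 𝟙 (Far x) * d x)
              ≡⟨ sym (∑-distrib-+ (λ x → 𝟙 (Near x) * d x) _) ⟩
            sum (λ x → 𝟙 (Near x) * d x + 𝟙 (Far x) * d x)
              ≡⟨ sum-cong-≗ (λ x → eq (T x) (N x) (d x)) ⟩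
            Σd ∎
            where
            eq : ∀ u v k → 𝟙 (u ∧ v) * k + 𝟙 (u ∧ not v) * k ≡ 𝟙 u * k
            eq false v k = refl
            eq true false k = refl
            eq true true k = +-identityʳ _

          high : B ≤ d x₁ → ⊥
          high B≤d₁ = no-violation-high B b c s t (d x₁ ∸ B) m (t ⊓ 2) (sym (m+[n∸m]≡n B≤d₁)) 0<c c≤b
            (m⊓n≤m t 2) (≤-trans (m⊓n≤n t 2) 2≤c) (degree-bound x₁) violation (sum-𝟙-≥ T d (d x₁) x₁-min) loss

          clique : d x₁ < B → (∀ x → Far x ≡ true → B ≤ d x) → ⊥
          clique d₁<B far = no-violation-clique b c (d x₁) (B ∸ d x₁) s p q m (sym (m+[n∸m]≡n (<⇒≤ d₁<B)))
            (m<n⇒0<n∸m d₁<B) 2≤c c≤b B≤b p≤ (degree-bound x₁) violation′ (≤-trans (split B far) loss₂)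

          -- A far vertex is distinct from and not adjacent to `x₁`. Since `d x₁ ≤ d x₂`, the bound
          -- on the degree of `x₂` also holds for that of `x₁`.
          far-pair : ∀ x₂ → Far x₂ ≡ true → (c + B) * n ≤ (d x₂ + s + i) * K
          far-pair x₂ Fx₂ with T x₂ in Tx₂ | x₁ ≟F x₂ | adj G x₁ x₂ in Gx₁x₂
          ... | true | no x₁≢x₂ | false = ≤-trans (nonadjacent x₁ x₂ x₁≢x₂ Gx₁x₂) (*-monoˡ-≤ K (⊔-lub
                  (≤-trans (deg≤ x₁) (+-monoˡ-≤ i (+-monoˡ-≤ s (x₁-min x₂ Tx₂)))) (deg≤ x₂)))

          spread : ∀ x₂ → Far x₂ ≡ true → (∀ y → Far y ≡ true → d x₂ ≤ d y) → d x₂ < B → ⊥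
          spread x₂ Fx₂ x₂-min d₂<B with d x₂ ≟ 0
          -- Dropping `Σh` from the violation gives `c * s < t * B`, from which this case follows.
          ... | yes d₂≡0 = no-violation-isolated B c s t i n 0<c K≡ (≤-<-trans (m≤m+n _ Σh) violation) fits
                  (subst (λ z → (c + B) * n ≤ (z + s + i) * K) d₂≡0 (far-pair x₂ Fx₂)) independent-small
          ... | no d₂≢0 = no-violation-nonadjacent c (d x₁) (d x₂ ∸ d x₁) (B ∸ d x₂) s p q i n m
                  (sym (m+[n∸m]≡n (x₁-min x₂ (∧-fst Fx₂)))) (sym (m+[n∸m]≡n (<⇒≤ d₂<B))) K≡ (n≢0⇒n>0 d₂≢0)
                  p≤ violation′ (≤-trans (split (d x₂) x₂-min) loss₂)
                  (subst (λ z → i + s + z ≤ n) (sym p+q≡t) fits) (far-pair x₂ Fx₂) independent-small large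

          contradict : ⊥
          contradict with d x₁ <? B
          ... | no d₁≮B = high (≮⇒≥ d₁≮B)
          ... | yes d₁<B with argmin Far d
          -- Without far vertices their lower bound `B` holds vacuously, so the case merges with the
          -- one where all far degrees are at least `B`.
          ...   | inj₁ none = clique d₁<B (λ x Fx → ⊥-elim (not-¬ (none x) Fx))
          ...   | inj₂ (x₂ , Fx₂ , x₂-min) with d x₂ <? B
          ...     | yes d₂<B = spread x₂ Fx₂ x₂-min d₂<B
          ...     | no d₂≮B = clique d₁<B (λ x Fx → ≤-trans (≮⇒≥ d₂≮B) (x₂-min x Fx))

        absurd-at : (∀ x → T x ≡ false) ⊎ (Σ (Fin n) λ x → T x ≡ true × (∀ y → T y ≡ true → d x ≤ d y)) → ⊥
        absurd-at (inj₂ (x₁ , Tx₁ , x₁-min)) = contradict x₁ x₁-min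
        absurd-at (inj₁ none) = n≮0 (subst (λ z → c * s + Σh < z * B)
          (trans (sum-cong-≗ (λ x → cong 𝟙 (none x))) (sum-zero n)) violation)

theorem5 : (n : ℕ) (G : Graph n) (b a m Δ : ℕ) →
    2 ≤ a → a + Δ ≤ b →
    (∀ x → (Δ + a) * (Δ + a) * n + b * (b ∸ Δ) * (b + 2 * a + Δ) + m * (b + 2 * a + Δ) * (Δ + a)
    ≤ deg G x * (b + 2 * a + Δ) * (Δ + a)) →
    (b + a + 2 * m ∸ 1) * (b + 2 * a + Δ) < n * (Δ + a) →
    (g f : Fin n → ℕ) →
    (∀ x → f x ≤ b) → (∀ x → g x + Δ ≤ f x) → (∀ x → a ≤ g x) →
    (∀ x y → x ≢ y → adj G x y ≡ false →
    (b + a) * n ≤ (deg G x ⊔ deg G y) * (b + 2 * a + Δ)) →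
    FracIDDeleted G g f m
theorem5 n G b a m Δ 2≤a a+Δ≤b minDegree large g f f≤b g+Δ≤f a≤g nonadjacent I indep H H⊆ count =
  case fracFactor-or-violator (Remaining I) (RemainingEdge G I H) (remainingEdge-sym G I H H⊆) (remainingEdge⊆remaining G I H H⊆) g f g≤f of λ
    { (inj₁ F) → F
    ; (inj₂ v) → ⊥-elim (no-violator G b c B K m (≤-trans 2≤a (m≤n+m a Δ)) (subst (_≤ b) (+-comm a Δ) a+Δ≤b) (m∸n≤m b Δ)
        K≡ minDegree large′ (λ x y x≢y Gxy → subst (λ z → z * n ≤ (deg G x ⊔ deg G y) * K) W≡ (nonadjacent x y x≢y Gxy))
        I indep g f
        -- `c ≤ f` comes from `a + Δ ≤ g + Δ ≤ f`, and `g ≤ B` from `g + Δ ≤ f ≤ b`; the counting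
        -- uses these constants in place of `f` and `g`.
        (λ x → ≤-trans (subst (Δ + a ≤_) (+-comm Δ (g x)) (+-monoʳ-≤ Δ (a≤g x))) (g+Δ≤f x))
        (λ x → m+n≤o⇒m≤o∸n (g x) (≤-trans (g+Δ≤f x) (f≤b x))) H H⊆ count v) }
  where
  c B K : ℕ
  c = Δ + a
  B = b ∸ Δ
  K = b + 2 * a + Δ
  g≤f : ∀ x → g x ≤ f x
  g≤f x = m+n≤o⇒m≤o (g x) (g+Δ≤f x)
  b≡ : b ≡ B + Δ
  b≡ = sym (m∸n+n≡m (m+n≤o⇒n≤o a a+Δ≤b))
  K≡ : K ≡ c + B + c
  K≡ = trans (cong (λ z → z + 2 * a + Δ) b≡) (identity B Δ a)
    where
    identity : ∀ B Δ a → B + Δ + 2 * a + Δ ≡ Δ + a + B + (Δ + a)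
    identity B Δ a = solve (B ∷ Δ ∷ a ∷ [])
  W≡ : b + a ≡ c + B
  W≡ = trans (cong (_+ a) b≡) (identity B Δ a)
    where
    identity : ∀ B Δ a → B + Δ + a ≡ Δ + a + B
    identity B Δ a = solve (B ∷ Δ ∷ a ∷ [])
  large′ : (c + B + 2 * m) * K < n * c + K
  large′ = begin-strict
    (c + B + 2 * m) * K                  ≡⟨ cong (λ z → (z + 2 * m) * K) (sym W≡) ⟩
    -- The truncated subtraction of 1 is exact because `2 ≤ a`; the unit restored becomes the
    -- summand `K` on the right.
    (b + a + 2 * m) * K                  ≡⟨ cong (_* K) (sym (m∸n+n≡m {b + a + 2 * m} {1}
                                              (≤-trans (≤-trans (s≤s z≤n) 2≤a) (≤-trans (m≤n+m a b) (m≤m+n _ (2 * m)))))) ⟩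
    (b + a + 2 * m ∸ 1 + 1) * K          ≡⟨ *-distribʳ-+ K (b + a + 2 * m ∸ 1) 1 ⟩
    (b + a + 2 * m ∸ 1) * K + 1 * K      <⟨ +-mono-<-≤ large (≤-reflexive (*-identityˡ K)) ⟩
    n * c + K                            ∎
    where open ≤-Reasoning
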